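{- Let $d\geq 1$ be a fixed integer and let $\mathcal{C}$ be a class of graphs. The problem $d$-Bondage can be solved in polynomial time for graphs in $\mathcal{C}$ if at least one of the following holds: (1) $\mathcal{C}$ is closed under edge deletions and Dominating Set can be solved in polynomial time for $\mathcal{C}$; or (2) $\mathcal{C}$ is the class of $H$-free graphs, where $H$ is a fixed graph with minimum degree $\delta(H)\geq 2$, and Dominating Set can be solved in polynomial time for $\mathcal{C}$; or (3) for every $G\in\mathcal{C}$, $\gamma(G)\leq k$, where $k$ is a fixed constant.
   Context: All graphs are finite, simple and undirected. A set $S\subseteq V(G)$ is a dominating set of a graph $G$ if every vertex of $G$ is in $S$ or is adjacent to an element of $S$; $\gamma(G)$ denotes the minimum cardinality of a dominating set of $G$. Dominating Set is the problem of deciding, given a graph $G$ and an integer $k\geq 1$, whether $\gamma(G)\leq k$. The bondage number $b(G)$ is the minimum number of edges whose removal from $G$ increases the domination number, i.e. the smallest cardinality of a set $E'\subseteq E(G)$ such that $\gamma(G-E')=\gamma(G)+1$, where $G-E'=(V(G),E(G)\setminus E')$. For a fixed integer $d\geq 1$, $d$-Bondage is the decision problem: instance, a graph $G$; question, is $b(G)\leq d$? A class $\mathcal{C}$ of graphs is closed under edge deletions if $G-e\in\mathcal{C}$ for every $G\in\mathcal{C}$ and every $e\in E(G)$. A graph is $H$-free if it has no induced subgraph isomorphic to $H$. A problem is solvable in polynomial time for $\mathcal{C}$ if it is solvable in polynomial time when the input graph is restricted to belong to $\mathcal{C}$. -}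

module Defs where

open import Data.Bool.Base using (Bool; true; false; _∧_; _∨_; not; T)
open import Data.Bool.Properties using (∨-comm)
open import Data.Fin.Base as Fin using (Fin)
import Data.Fin.Properties as Fin
open import Data.Fin.Subset using (Subset; _∈_; ∣_∣)
open import Data.List.Base as List using (List; []; _∷_; length)
import Data.List.Membership.DecPropositional as DecMembership
open import Data.List.Relation.Unary.All using (All)
open import Data.List.Relation.Unary.Unique.Propositional using (Unique)
open import Data.Nat.Base using (ℕ; suc; _+_; _*_; _^_; _≤_)
open import Data.Nat.Binary.Base using (ℕᵇ; 2[1+_]; 1+[2_]; fromℕ)
open import Data.Product.Base using (∃; _×_; _,_)
open import Data.Product.Properties using (≡-dec)
open import Data.Sum.Base using (_⊎_)
open import Data.Vec.Base as Vec using (Vec; _∷_; lookup; replicate; tabulate; _[_]≔_)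
open import Function.Bundles using (_⇔_)
open import Function.Definitions using (Injective)
open import Relation.Binary.Definitions using (DecidableEquality)
open import Relation.Binary.PropositionalEquality.Core using (_≡_; cong; cong₂)
open import Relation.Nullary.Decidable using (does)
open import Relation.Nullary.Negation using (¬_)
open import Relation.Unary using (Pred)

IsMinimum : (ℕ → Set) → ℕ → Set
IsMinimum P m = P m × (∀ n → P n → m ≤ n)

------------------------------------------------------------------------
-- Graphs

record Graph : Set where
  field
    order      : ℕ
    adj        : Fin order → Fin order → Bool
    adj-sym    : ∀ u v → adj u v ≡ adj v u
    adj-irrefl : ∀ v → adj v v ≡ false

open Graph public

Vertex : Graph → Set
Vertex G = Fin (order G)

Adj : (G : Graph) → Vertex G → Vertex G → Set
Adj G u v = T (adj G u v)

degree : (G : Graph) → Vertex G → ℕ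
degree G v = ∣ tabulate (adj G v) ∣

-- δ(H); a graph without vertices has no minimum degree.
IsMinimumDegree : Graph → ℕ → Set
IsMinimumDegree G = IsMinimum (λ n → ∃ λ v → degree G v ≡ n)

IsDominating : (G : Graph) → Subset (order G) → Set
IsDominating G S = ∀ v → v ∈ S ⊎ ∃ λ u → u ∈ S × Adj G v u

IsDominationNumber : Graph → ℕ → Set
IsDominationNumber G = IsMinimum (λ n → ∃ λ S → IsDominating G S × ∣ S ∣ ≡ n)

γ[_]≤_ : Graph → ℕ → Set
γ[ G ]≤ k = ∃ λ m → IsDominationNumber G m × m ≤ k

-- An undirected edge is represented by the pair of its ends in increasing
-- order, so that a set of edges is a duplicate-free list of such pairs.
IsEdge : (G : Graph) → Vertex G × Vertex G → Set
IsEdge G (u , v) = u Fin.< v × Adj G u v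

IsEdgeSet : (G : Graph) → List (Vertex G × Vertex G) → Set
IsEdgeSet G E = All (IsEdge G) E × Unique E

_≟ᵖ_ : ∀ {n} → DecidableEquality (Fin n × Fin n)
_≟ᵖ_ = ≡-dec Fin._≟_ Fin._≟_

module _ {n : ℕ} where
  open DecMembership (_≟ᵖ_ {n}) using (_∈?_)

  joins : List (Fin n × Fin n) → Fin n → Fin n → Bool
  joins E u v = does ((u , v) ∈? E) ∨ does ((v , u) ∈? E)

  joins-sym : ∀ E u v → joins E u v ≡ joins E v u
  joins-sym E u v = ∨-comm (does ((u , v) ∈? E)) (does ((v , u) ∈? E))

infixl 6 _─_

_─_ : (G : Graph) → List (Vertex G × Vertex G) → Graph
G ─ E = record
  { order      = order G
  ; adj        = λ u v → adj G u v ∧ not (joins E u v)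
  ; adj-sym    = λ u v → cong₂ (λ a b → a ∧ not b) (adj-sym G u v) (joins-sym E u v)
  ; adj-irrefl = λ v → cong (_∧ not (joins E v v)) (adj-irrefl G v)
  }

IsBondageNumber : Graph → ℕ → Set
IsBondageNumber G = IsMinimum λ n → ∃ λ E → IsEdgeSet G E × length E ≡ n ×
  ∃ λ m → IsDominationNumber G m × IsDominationNumber (G ─ E) (m + 1)

-- An edgeless graph has no bondage number, so this is false for it.
b[_]≤_ : Graph → ℕ → Set
b[ G ]≤ d = ∃ λ n → IsBondageNumber G n × n ≤ d

ClosedUnderEdgeDeletion : ∀ {ℓ} → Pred Graph ℓ → Set ℓ
ClosedUnderEdgeDeletion C = ∀ G → C G → ∀ e → IsEdge G e → C (G ─ (e ∷ []))

-- An injective, adjacency-preserving and -reflecting map is an isomorphism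
-- from H onto the subgraph of G induced by its image.
InducedCopy : Graph → Graph → Set
InducedCopy H G = ∃ λ (f : Vertex H → Vertex G) →
  Injective _≡_ _≡_ f × (∀ u v → adj G (f u) (f v) ≡ adj H u v)

Free : Graph → Pred Graph _
Free H G = ¬ InducedCopy H G

------------------------------------------------------------------------
-- Polynomial time
--
-- The machine model is N. D. Jones's WHILE language ("Computability and
-- Complexity from a Programming Perspective"): imperative programs with
-- finitely many variables, each holding a binary tree.  Every expression
-- node, assignment, sequencing and loop test costs one time unit.  Since
-- trees can be kept as shared pointers and tests only look at the root,
-- this measure is polynomially related to Turing machine time.

infixr 5 _∙_

data Tree : Set where
  nil : Tree
  _∙_ : Tree → Tree → Tree

size : Tree → ℕ
size nil     = 1
size (s ∙ t) = suc (size s + size t)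

hd : Tree → Tree
hd nil     = nil
hd (s ∙ t) = s

tl : Tree → Tree
tl nil     = nil
tl (s ∙ t) = t

data Expr (n : ℕ) : Set where
  var     : Fin n → Expr n
  nilᵉ    : Expr n
  consᵉ   : Expr n → Expr n → Expr n
  hdᵉ tlᵉ : Expr n → Expr n

infix  4 _≔_
infixr 3 _⨾_

data Cmd (n : ℕ) : Set where
  _≔_       : Fin n → Expr n → Cmd n
  _⨾_       : Cmd n → Cmd n → Cmd n
  while_⟨_⟩ : Expr n → Cmd n → Cmd n

Store : ℕ → Set
Store n = Vec Tree n

private variable
  n t t′ : ℕ

eval : Expr n → Store n → Tree
eval (var x)     σ = lookup σ x
eval nilᵉ        σ = nil
eval (consᵉ e f) σ = eval e σ ∙ eval f σ
eval (hdᵉ e)     σ = hd (eval e σ)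
eval (tlᵉ e)     σ = tl (eval e σ)

cost : Expr n → ℕ
cost (var x)     = 1
cost nilᵉ        = 1
cost (consᵉ e f) = suc (cost e + cost f)
cost (hdᵉ e)     = suc (cost e)
cost (tlᵉ e)     = suc (cost e)

-- ⟨ c , σ ⟩⇓[ t ] ρ : started in store σ, the command c terminates after
-- exactly t time units in store ρ.
infix 2 ⟨_,_⟩⇓[_]_

data ⟨_,_⟩⇓[_]_ {n : ℕ} : Cmd n → Store n → ℕ → Store n → Set where
  assign : ∀ {x e σ} →
           ⟨ x ≔ e , σ ⟩⇓[ suc (cost e) ] σ [ x ]≔ eval e σ
  seq    : ∀ {c d σ ρ τ} →
           ⟨ c , σ ⟩⇓[ t ] ρ → ⟨ d , ρ ⟩⇓[ t′ ] τ →
           ⟨ c ⨾ d , σ ⟩⇓[ suc (t + t′) ] τ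
  stop   : ∀ {e c σ} → eval e σ ≡ nil →
           ⟨ while e ⟨ c ⟩ , σ ⟩⇓[ suc (cost e) ] σ
  loop   : ∀ {e c σ ρ τ} → ¬ eval e σ ≡ nil →
           ⟨ c , σ ⟩⇓[ t ] ρ → ⟨ while e ⟨ c ⟩ , ρ ⟩⇓[ t′ ] τ →
           ⟨ while e ⟨ c ⟩ , σ ⟩⇓[ suc (cost e + t + t′) ] τ

-- Variable 0 holds the input at the start and the output at the end; the
-- auxiliary variables are initially nil.
record Program : Set where
  field
    auxiliary : ℕ
    body      : Cmd (suc auxiliary)

open Program public

_on_yields_in-time_ : Program → Tree → Tree → ℕ → Set
P on x yields y in-time t = ∃ λ ρ →
  (⟨ body P , x ∷ replicate (auxiliary P) nil ⟩⇓[ t ] ρ) × Vec.head ρ ≡ y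

record Problem : Set₁ where
  field
    Instance : Set
    code     : Instance → Tree
    Yes      : Instance → Set

open Problem public

codeBool : Bool → Tree
codeBool false = nil
codeBool true  = nil ∙ nil

codeList : ∀ {A : Set} → (A → Tree) → List A → Tree
codeList f []       = nil
codeList f (x ∷ xs) = f x ∙ codeList f xs

-- The problem is solvable in polynomial time for the inputs in R.  Nothing is
-- required on inputs outside R.
PolyTime : ∀ {ℓ} (Π : Problem) → Pred (Instance Π) ℓ → Set ℓ
PolyTime Π R =
  ∃ λ (P : Program) → ∃ λ (c : ℕ) → ∃ λ (k : ℕ) → ∀ x → R x →
  ∃ λ (answer : Bool) → ∃ λ (t : ℕ) →
    (P on code Π x yields codeBool answer in-time t) ×
    t ≤ c * suc (size (code Π x)) ^ k ×
    (T answer ⇔ Yes Π x)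

-- Numbers are written in (bijective) binary, least significant digit first.
codeℕᵇ : ℕᵇ → Tree
codeℕᵇ ℕᵇ.zero  = nil
codeℕᵇ 1+[2 x ] = codeBool false ∙ codeℕᵇ x
codeℕᵇ 2[1+ x ] = codeBool true ∙ codeℕᵇ x

codeℕ : ℕ → Tree
codeℕ k = codeℕᵇ (fromℕ k)

-- The list of the rows of the adjacency matrix.
codeGraph : Graph → Tree
codeGraph G = codeList (codeList codeBool)
  (List.tabulate λ u → List.tabulate λ v → adj G u v)

DominatingSet : Problem
DominatingSet = record
  { Instance = Graph × ∃ λ k → 1 ≤ k
  ; code     = λ (G , k , _) → codeGraph G ∙ codeℕ k
  ; Yes      = λ (G , k , _) → γ[ G ]≤ k
  }

Bondage : ℕ → Problem
Bondage d = record
  { Instance = Graph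
  ; code     = codeGraph
  ; Yes      = λ G → b[ G ]≤ d
  }

DominatingSetPolyTimeFor : ∀ {ℓ} → Pred Graph ℓ → Set ℓ
DominatingSetPolyTimeFor C = PolyTime DominatingSet (λ (G , _) → C G)

BondagePolyTimeFor : ∀ {ℓ} → ℕ → Pred Graph ℓ → Set ℓ
BondagePolyTimeFor d C = PolyTime (Bondage d) C

{-# OPTIONS --safe #-}
-- Deleting an edge raises γ by at most one, so b(G) ≤ d iff there are a list E
-- of at most d pairs of vertices and a threshold k with γ(G) ≤ k < γ(G - E).
-- As d is fixed, all of these can be tried, and it remains to decide whether
-- γ(G - E) ≤ k.  In case (1), G - E is in the class.  In case (3), all sets of
-- at most k vertices are tried.  In case (2), G - E may contain H, but a set
-- that contains, for every end u of a pair in E, a vertex dominating u in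
-- G - E dominates G - E as soon as it dominates G.  So these vertices are
-- guessed, and they are forced into the dominating set by attaching a pendant
-- vertex to each of them in G, which creates no copy of H because δ(H) ≥ 2.
--
-- Programs are put together from combinators on commands that take f i to g i
-- in time polynomial in μ i, where the index i consists of the input and of
-- the variables bound by the enclosing loops.  Because time is measured in i
-- and not in the argument f i, the bounds compose although the size of a
-- WHILE value can be exponential in the running time.
module Submission where

open import Defs
open import Level using (Level)
open import Data.Bool.Base using (Bool; true; false; if_then_else_; T; not; _∧_; _∨_)
open import Data.Bool.ListAction using (any)
open import Data.Bool.Properties using (T?; T-∧; T-∨)
open import Data.Fin.Base as Fin using (Fin; zero; suc; toℕ; fromℕ<; combine)
import Data.Fin.Properties as Fin
open import Data.Fin.Subset as Subset using (Subset; _∈_; ∣_∣; inside; outside)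
import Data.Fin.Subset.Properties as Subset
open import Data.List.Base as List using (List; []; _∷_; _++_; length; reverse; _ʳ++_; tabulate; allFin)
import Data.List.Membership.DecPropositional as DecMembership
open import Data.List.Membership.Propositional using () renaming (_∈_ to _∈ˡ_)
open import Data.List.Membership.Propositional.Properties using (∈-tabulate⁺; ∈-tabulate⁻)
import Data.List.Properties as List
open import Data.List.Relation.Unary.All using (All; []; _∷_) renaming (lookup to lookupAll)
import Data.List.Relation.Unary.All.Properties as All
open import Data.List.Relation.Unary.AllPairs using ([]; _∷_)
open import Data.List.Relation.Unary.Any using (here; there)
open import Data.List.Relation.Unary.Unique.Propositional using (Unique)
open import Data.Nat.Base using (ℕ; zero; suc; _+_; _*_; _∸_; _^_; _≤_; _<_; z≤n; s≤s)
open import Data.Nat.Binary.Base as ℕᵇ using (ℕᵇ; 1+[2_]; 2[1+_]; fromℕ')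
open import Data.Nat.Binary.Properties using (fromℕ≡fromℕ')
open import Data.Nat.Properties
open import Data.Product.Base using (∃; Σ; _×_; _,_; proj₁; proj₂)
open import Data.Product.Properties using (,-injectiveˡ; ,-injectiveʳ)
open import Data.Sum.Base as Sum using (_⊎_; inj₁; inj₂; [_,_]′)
open import Data.Unit.Base using (⊤; tt)
open import Data.Vec.Base as Vec using (Vec; []; _∷_; lookup; replicate; _[_]≔_; here; there)
import Data.Vec.Properties as Vec
open import Function.Base using (_∘_; id)
open import Function.Bundles using (_⇔_; mk⇔; Equivalence)
import Function.Properties.Equivalence as ⇔
open import Relation.Binary.Definitions using (tri<; tri≈; tri>)
open import Relation.Binary.PropositionalEquality
open import Relation.Nullary.Decidable as Dec using (Dec; yes; no; does; _×-dec_; _⊎-dec_)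
open import Relation.Nullary.Negation using (¬_; contradiction)
open import Relation.Unary using (Pred; Decidable)
open Equivalence using (to; from)

private variable
  ℓ : Level

-- Polynomial bounds

-- The form of the bound is that of `PolyTime`. It is closed under sums and products, so time bounds
-- compose.
PolyBounded : {I : Set ℓ} → (I → ℕ) → (I → ℕ) → Set ℓ
PolyBounded μ h = ∃ λ c → ∃ λ k → ∀ i → h i ≤ c * suc (μ i) ^ k

module _ {I : Set ℓ} {μ : I → ℕ} where

  pb-const : ∀ n → PolyBounded μ (λ _ → n)
  pb-const n = n , 0 , λ _ → ≤-reflexive (sym (*-identityʳ n))

  pb-self : PolyBounded μ μ
  pb-self = 1 , 1 , λ i → ≤-trans (n≤1+n _) (≤-reflexive (sym (trans (*-identityˡ _) (^-identityʳ _))))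

  pb-mono : ∀ {g h} → (∀ i → g i ≤ h i) → PolyBounded μ h → PolyBounded μ g
  pb-mono g≤h (c , k , h≤) = c , k , λ i → ≤-trans (g≤h i) (h≤ i)

  pb-+ : ∀ {g h} → PolyBounded μ g → PolyBounded μ h → PolyBounded μ (λ i → g i + h i)
  pb-+ {g} {h} (c , k , g≤) (d , l , h≤) = c + d , k + l , λ i → begin
    g i + h i                                           ≤⟨ +-mono-≤ (g≤ i) (h≤ i) ⟩
    c * suc (μ i) ^ k + d * suc (μ i) ^ l               ≤⟨ +-mono-≤ (*-monoʳ-≤ c (^-monoʳ-≤ (suc (μ i)) (m≤m+n k l)))
                                                                    (*-monoʳ-≤ d (^-monoʳ-≤ (suc (μ i)) (m≤n+m l k))) ⟩
    c * suc (μ i) ^ (k + l) + d * suc (μ i) ^ (k + l)   ≡⟨ *-distribʳ-+ (suc (μ i) ^ (k + l)) c d ⟨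
    (c + d) * suc (μ i) ^ (k + l)                       ∎
    where open ≤-Reasoning

  pb-* : ∀ {g h} → PolyBounded μ g → PolyBounded μ h → PolyBounded μ (λ i → g i * h i)
  pb-* {g} {h} (c , k , g≤) (d , l , h≤) = c * d , k + l , λ i → begin
    g i * h i                                     ≤⟨ *-mono-≤ (g≤ i) (h≤ i) ⟩
    (c * suc (μ i) ^ k) * (d * suc (μ i) ^ l)     ≡⟨ [m*n]*[o*p]≡[m*o]*[n*p] c _ d _ ⟩
    (c * d) * (suc (μ i) ^ k * suc (μ i) ^ l)     ≡⟨ cong (c * d *_) (^-distribˡ-+-* (suc (μ i)) k l) ⟨
    (c * d) * suc (μ i) ^ (k + l)                 ∎
    where open ≤-Reasoning

  pb-suc : ∀ {h} → PolyBounded μ h → PolyBounded μ (λ i → suc (h i))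
  pb-suc = pb-+ (pb-const 1)

  pb-^ : ∀ {h} → PolyBounded μ h → ∀ n → PolyBounded μ (λ i → h i ^ n)
  pb-^ h≤ zero    = pb-const 1
  pb-^ h≤ (suc n) = pb-* h≤ (pb-^ h≤ n)

-- Runs of WHILE commands

-- An upper bound replaces the exact time, so that it may be weakened to a uniform expression.
Runs : ∀ {n} → Cmd n → Store n → ℕ → Store n → Set
Runs c σ b ρ = ∃ λ t → (⟨ c , σ ⟩⇓[ t ] ρ) × t ≤ b

runs-assign : ∀ {n} {x : Fin n} {e σ} → Runs (x ≔ e) σ (suc (cost e)) (σ [ x ]≔ eval e σ)
runs-assign = _ , assign , ≤-refl

runs-seq : ∀ {n} {c d : Cmd n} {σ ρ τ b b′} →
           Runs c σ b ρ → Runs d ρ b′ τ → Runs (c ⨾ d) σ (suc (b + b′)) τ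
runs-seq (_ , r , t≤) (_ , r′ , t′≤) = _ , seq r r′ , s≤s (+-mono-≤ t≤ t′≤)

runs-stop : ∀ {n} {e} {c : Cmd n} {σ} → eval e σ ≡ nil → Runs (while e ⟨ c ⟩) σ (suc (cost e)) σ
runs-stop e≡nil = _ , stop e≡nil , ≤-refl

runs-loop : ∀ {n} {e} {c : Cmd n} {σ ρ τ b b′} → eval e σ ≢ nil →
            Runs c σ b ρ → Runs (while e ⟨ c ⟩) ρ b′ τ →
            Runs (while e ⟨ c ⟩) σ (suc (cost e + b + b′)) τ
runs-loop {e = e} e≢nil (_ , r , t≤) (_ , r′ , t′≤) =
  _ , loop e≢nil r r′ , s≤s (+-mono-≤ (+-monoʳ-≤ (cost e) t≤) t′≤)

runs-≤ : ∀ {n} {c : Cmd n} {σ ρ b b′} → b ≤ b′ → Runs c σ b ρ → Runs c σ b′ ρ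
runs-≤ b≤ (_ , r , t≤) = _ , r , ≤-trans t≤ b≤

-- Running a program beside one additional variable.

module _ {a : ℕ} where

  skip₁ : Fin (suc a) → Fin (2 + a)
  skip₁ zero    = zero
  skip₁ (suc x) = suc (suc x)

  insert₁ : Tree → Store (suc a) → Store (2 + a)
  insert₁ s (x ∷ σ) = x ∷ s ∷ σ

  embedᵉ : Expr (suc a) → Expr (2 + a)
  embedᵉ (var x)     = var (skip₁ x)
  embedᵉ nilᵉ        = nilᵉ
  embedᵉ (consᵉ e f) = consᵉ (embedᵉ e) (embedᵉ f)
  embedᵉ (hdᵉ e)     = hdᵉ (embedᵉ e)
  embedᵉ (tlᵉ e)     = tlᵉ (embedᵉ e)

  embed : Cmd (suc a) → Cmd (2 + a)
  embed (x ≔ e)       = skip₁ x ≔ embedᵉ e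
  embed (c ⨾ d)       = embed c ⨾ embed d
  embed while e ⟨ c ⟩ = while embedᵉ e ⟨ embed c ⟩

  cost-embed : ∀ e → cost (embedᵉ e) ≡ cost e
  cost-embed (var x)     = refl
  cost-embed nilᵉ        = refl
  cost-embed (consᵉ e f) = cong suc (cong₂ _+_ (cost-embed e) (cost-embed f))
  cost-embed (hdᵉ e)     = cong suc (cost-embed e)
  cost-embed (tlᵉ e)     = cong suc (cost-embed e)

  module _ (s : Tree) where

    lookup-insert₁ : ∀ σ x → lookup (insert₁ s σ) (skip₁ x) ≡ lookup σ x
    lookup-insert₁ (_ ∷ σ) zero    = refl
    lookup-insert₁ (_ ∷ σ) (suc x) = refl

    eval-embed : ∀ e σ → eval (embedᵉ e) (insert₁ s σ) ≡ eval e σ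
    eval-embed (var x)     σ = lookup-insert₁ σ x
    eval-embed nilᵉ        σ = refl
    eval-embed (consᵉ e f) σ = cong₂ _∙_ (eval-embed e σ) (eval-embed f σ)
    eval-embed (hdᵉ e)     σ = cong hd (eval-embed e σ)
    eval-embed (tlᵉ e)     σ = cong tl (eval-embed e σ)

    update-insert₁ : ∀ σ x v → insert₁ s σ [ skip₁ x ]≔ v ≡ insert₁ s (σ [ x ]≔ v)
    update-insert₁ (_ ∷ σ) zero    v = refl
    update-insert₁ (_ ∷ σ) (suc x) v = refl

    runs-embed : ∀ {c σ t ρ} → ⟨ c , σ ⟩⇓[ t ] ρ → Runs (embed c) (insert₁ s σ) t (insert₁ s ρ)
    runs-embed (assign {x = x} {e = e} {σ = σ}) =
      subst₂ (Runs (embed (x ≔ e)) (insert₁ s σ)) (cong suc (cost-embed e))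
        (trans (update-insert₁ σ x _) (cong (λ v → insert₁ s (σ [ x ]≔ v)) (eval-embed e σ)))
        runs-assign
    runs-embed (seq r r′) = runs-seq (runs-embed r) (runs-embed r′)
    runs-embed (stop {e = e} {c = c} {σ = σ} e≡nil) =
      subst (λ b → Runs (embed while e ⟨ c ⟩) (insert₁ s σ) b (insert₁ s σ)) (cong suc (cost-embed e))
        (runs-stop (trans (eval-embed e σ) e≡nil))
    runs-embed (loop {t = t} {t′ = t′} {e = e} {c = c} {σ = σ} {τ = τ} e≢nil r r′) =
      subst (λ b → Runs (embed while e ⟨ c ⟩) (insert₁ s σ) (suc (b + t + t′)) (insert₁ s τ)) (cost-embed e)
        (runs-loop (e≢nil ∘ trans (sym (eval-embed e σ))) (runs-embed r) (runs-embed r′))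

-- A program expects its auxiliary variables to be nil, whereas earlier commands leave arbitrary
-- values in them.
clear : ∀ {N} k → (Fin k → Fin (suc N)) → Cmd (suc N)
-- A loop that is never entered serves as the empty command.
clear zero    ι = while nilᵉ ⟨ zero ≔ nilᵉ ⟩
clear (suc k) ι = (ι zero ≔ nilᵉ) ⨾ clear k (ι ∘ suc)

cleared : ∀ {N} k → (Fin k → Fin N) → Store N → Store N
cleared zero    ι σ = σ
cleared (suc k) ι σ = cleared k (ι ∘ suc) (σ [ ι zero ]≔ nil)

runs-clear : ∀ {N} k (ι : Fin k → Fin (suc N)) σ → Runs (clear k ι) σ (2 + k * 3) (cleared k ι σ)
runs-clear zero    ι σ = runs-stop refl
runs-clear (suc k) ι σ = runs-seq runs-assign (runs-clear k (ι ∘ suc) _)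

cleared-suc : ∀ {N} k (ι : Fin k → Fin N) x σ → cleared k (suc ∘ ι) (x ∷ σ) ≡ x ∷ cleared k ι σ
cleared-suc zero    ι x σ = refl
cleared-suc (suc k) ι x σ = cleared-suc k (ι ∘ suc) x _

cleared-all : ∀ {N} (σ : Store N) → cleared N id σ ≡ replicate N nil
cleared-all []      = refl
cleared-all (x ∷ σ) = trans (cleared-suc _ id nil σ) (cong (nil ∷_) (cleared-all σ))

-- Encodings

truthy : Tree → Bool
truthy nil     = false
truthy (_ ∙ _) = true

truthy-codeBool : ∀ b → truthy (codeBool b) ≡ b
truthy-codeBool false = refl
truthy-codeBool true  = refl

-- A position in a list, the elements before it being listed in reverse.
record Position {A : Set} (xs : List A) : Set where
  constructor position
  field
    passed : List A
    current   : A
    remaining  : List A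
    split  : passed ʳ++ current ∷ remaining ≡ xs

open Position public

-- Reversal exchanges what has been passed and what remains. This turns a left fold over the
-- reversed list into a right fold over the list.
mirror : ∀ {A : Set} {xs : List A} → Position (reverse xs) → Position xs
mirror {xs = xs} (position ps x ys eq) = position ys x ps (begin
  ys ʳ++ x ∷ ps             ≡⟨ cong (λ qs → ys ʳ++ x ∷ qs) (List.++-identityʳ ps) ⟨
  ys ʳ++ x ∷ (ps ++ [])     ≡⟨ List.ʳ++-ʳ++ ps ⟨
  reverse (ps ʳ++ x ∷ ys)   ≡⟨ cong reverse eq ⟩
  reverse (reverse xs)      ≡⟨ List.reverse-involutive xs ⟩
  xs                        ∎)
  where open ≡-Reasoning

remaining<length : ∀ {A : Set} {xs : List A} (p : Position xs) → length (remaining p) < length xs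
remaining<length {xs = xs} (position ps x ys eq) = begin-strict
  length ys                        <⟨ n<1+n _ ⟩
  suc (length ys)                  ≤⟨ m≤n+m _ (length ps) ⟩
  length ps + suc (length ys)      ≡⟨ List.length-ʳ++ ps ⟨
  length (ps ʳ++ x ∷ ys)           ≡⟨ cong length eq ⟩
  length xs                        ∎
  where open ≤-Reasoning

-- Numbers are handled in unary: a loop over a number is then a loop over a list, and taking tails
-- serves for comparison and for indexing.
num : ℕ → Tree
num zero    = nil
num (suc n) = nil ∙ num n

num-codeList : ∀ n → num n ≡ codeList (λ _ → nil) (List.replicate n tt)
num-codeList zero    = refl
num-codeList (suc n) = cong (nil ∙_) (num-codeList n)

vert : ∀ {n} → Fin n → Tree
vert v = num (toℕ v)

verts : ℕ → Tree
verts n = codeList vert (allFin n)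

codeList-tabulate : ∀ {A : Set} (f : A → Tree) {n} (g : Fin n → A) →
                    codeList f (tabulate g) ≡ codeList (f ∘ g) (allFin n)
codeList-tabulate f g = trans (cong (codeList f) (sym (List.map-tabulate id g))) (codeList-map (allFin _))
  where
  codeList-map : ∀ xs → codeList f (List.map g xs) ≡ codeList (f ∘ g) xs
  codeList-map []       = refl
  codeList-map (x ∷ xs) = cong (f (g x) ∙_) (codeList-map xs)

-- Commands computing a function in polynomial time

module Language (a : ℕ) where

  scratch : Fin a → Fin (2 + a)
  scratch x = suc (suc x)

  v₀ v₁ : Expr (2 + a)
  v₀ = var zero
  v₁ = var (suc zero)

  -- Variable 0 holds the value, variable 1 a stack that is left as it was
  -- found; the others are scratch.
  infix 3 _⊢_⟶_
  record _⊢_⟶_ {I : Set ℓ} (μ : I → ℕ) (f g : I → Tree) : Set ℓ where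
    field
      cmd   : Cmd (2 + a)
      bound : I → ℕ
      poly  : PolyBounded μ bound
      run   : ∀ i s τ → ∃ λ τ′ → Runs cmd (f i ∷ s ∷ τ) (bound i) (g i ∷ s ∷ τ′)

  open _⊢_⟶_ public

  module _ {I : Set ℓ} {μ : I → ℕ} where

    expr : ∀ {f g} (e : Expr (2 + a)) → (∀ i s τ → eval e (f i ∷ s ∷ τ) ≡ g i) → μ ⊢ f ⟶ g
    expr {f} e e≡g = record
      { cmd   = zero ≔ e
      ; bound = λ _ → suc (cost e)
      ; poly  = pb-const _
      ; run   = λ i s τ → τ , subst (λ y → Runs (zero ≔ e) (f i ∷ s ∷ τ) (suc (cost e)) (y ∷ s ∷ τ)) (e≡g i s τ) runs-assign
      }

    idᶜ : ∀ {f} → μ ⊢ f ⟶ f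
    idᶜ = expr v₀ λ _ _ _ → refl

    dropᶜ : ∀ {f g : I → Tree} → μ ⊢ (λ i → f i ∙ g i) ⟶ g
    dropᶜ = expr (tlᵉ v₀) λ _ _ _ → refl

    _≡ᶜ_ : ∀ {f g h} → μ ⊢ f ⟶ g → (∀ i → g i ≡ h i) → μ ⊢ f ⟶ h
    _≡ᶜ_ {f} F g≡h = record
      { cmd   = cmd F
      ; bound = bound F
      ; poly  = poly F
      ; run   = λ i s τ → let τ′ , r = run F i s τ in
          τ′ , subst (λ y → Runs (cmd F) (f i ∷ s ∷ τ) (bound F i) (y ∷ s ∷ τ′)) (g≡h i) r
      }

    infixl 5 _≫_ _≡ᶜ_
    _≫_ : ∀ {f g h} → μ ⊢ f ⟶ g → μ ⊢ g ⟶ h → μ ⊢ f ⟶ h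
    F ≫ G = record
      { cmd   = cmd F ⨾ cmd G
      ; bound = λ i → suc (bound F i + bound G i)
      ; poly  = pb-suc (pb-+ (poly F) (poly G))
      ; run   = λ i s τ → let τ₁ , r₁ = run F i s τ ; τ₂ , r₂ = run G i s τ₁ in
          τ₂ , runs-seq r₁ r₂
      }

    infix 4 ⟪_,_⟫
    ⟪_,_⟫ : ∀ {f g h} → μ ⊢ f ⟶ g → μ ⊢ f ⟶ h → μ ⊢ f ⟶ (λ i → g i ∙ h i)
    ⟪ F , G ⟫ = record
      -- The argument is pushed before `F` runs, and the result of `F` is pushed on top of it. The
      -- argument is then restored for `G`, and at the end both entries are popped.
      { cmd   = (suc zero ≔ consᵉ v₀ v₁) ⨾ cmd F ⨾
                (suc zero ≔ consᵉ v₀ v₁) ⨾ (zero ≔ hdᵉ (tlᵉ v₁)) ⨾ cmd G ⨾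
                (zero ≔ consᵉ (hdᵉ v₁) v₀) ⨾ (suc zero ≔ tlᵉ (tlᵉ v₁))
      ; bound = λ i → 6 + (bound F i + (11 + (bound G i + 10)))
      ; poly  = pb-+ (pb-const 6) (pb-+ (poly F) (pb-+ (pb-const 11) (pb-+ (poly G) (pb-const 10))))
      ; run   = λ i s τ → let τ₁ , r₁ = run F i _ τ ; τ₂ , r₂ = run G i _ τ₁ in
          τ₂ , runs-seq runs-assign (runs-seq r₁ (runs-seq runs-assign (runs-seq runs-assign
                 (runs-seq r₂ (runs-seq runs-assign runs-assign)))))
      }

    select : ∀ {c f g : I → Tree} → μ ⊢ (λ i → c i ∙ (f i ∙ g i)) ⟶ (λ i → if truthy (c i) then f i else g i)
    select {c} {f} {g} = record
      { cmd   = choose ⨾ (zero ≔ tlᵉ (tlᵉ v₀))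
      ; bound = λ _ → 21
      ; poly  = pb-const _
      ; run   = λ i s τ → τ , go (c i) (f i) (g i)
      }
      where
      choose : Cmd (2 + a)
      -- The language has no conditional. This loop is entered only if the test is true; it copies
      -- the first branch over the second and sets the test to nil, so it runs at most once.
      choose = while hdᵉ v₀ ⟨ zero ≔ consᵉ nilᵉ (consᵉ (hdᵉ (tlᵉ v₀)) (hdᵉ (tlᵉ v₀))) ⟩
      go : ∀ c x y {s τ} → Runs (choose ⨾ (zero ≔ tlᵉ (tlᵉ v₀))) ((c ∙ (x ∙ y)) ∷ s ∷ τ) 21
                                ((if truthy c then x else y) ∷ s ∷ τ)
      go nil     x y = runs-≤ (m≤m+n 8 13) (runs-seq (runs-stop refl) runs-assign)
      go (_ ∙ _) x y = runs-seq (runs-loop (λ ()) runs-assign (runs-stop refl)) runs-assign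

    keeping : ∀ {x f g h : I → Tree} → μ ⊢ (λ i → x i ∙ (f i ∙ g i)) ⟶ h →
              μ ⊢ (λ i → x i ∙ (f i ∙ g i)) ⟶ (λ i → f i ∙ h i)
    keeping F = ⟪ expr (hdᵉ (tlᵉ v₀)) (λ _ _ _ → refl) , F ⟫

  reindex : ∀ {I : Set ℓ} {μ : I → ℕ} {J : Set ℓ} (h : J → I) {f g} → μ ⊢ f ⟶ g → (μ ∘ h) ⊢ (f ∘ h) ⟶ (g ∘ h)
  reindex h F = record
    { cmd = cmd F ; bound = bound F ∘ h ; poly = let c , k , b≤ = poly F in c , k , b≤ ∘ h ; run = run F ∘ h }

  -- A complete program becomes a subroutine: its auxiliary variables are the scratch, reset
  -- beforehand, and its embedded body leaves the stack alone.
  runᶜ : ∀ {I : Set ℓ} {μ : I → ℕ} {f g} (c : Cmd (suc a)) (b : I → ℕ) → PolyBounded μ b →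
         (∀ i → ∃ λ ρ → Runs c (f i ∷ replicate a nil) (b i) ρ × Vec.head ρ ≡ g i) → μ ⊢ f ⟶ g
  runᶜ {f = f} {g = g} c b b≤ runs = record
    { cmd   = clear a scratch ⨾ embed c
    ; bound = λ i → suc (2 + a * 3 + b i)
    ; poly  = pb-suc (pb-+ (pb-const _) b≤)
    ; run   = λ i s τ → let ρ , r , eq = runs i in go i s τ ρ r eq
    }
    where
    go : ∀ i s τ ρ → Runs c (f i ∷ replicate a nil) (b i) ρ → Vec.head ρ ≡ g i →
         ∃ λ τ′ → Runs (clear a scratch ⨾ embed c) (f i ∷ s ∷ τ) (suc (2 + a * 3 + b i)) (g i ∷ s ∷ τ′)
    go i s τ (_ ∷ τ′) (t , r , t≤) refl = τ′ , runs-seq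
      (subst (Runs (clear a scratch) (f i ∷ s ∷ τ) (2 + a * 3))
        (trans (cleared-suc a suc (f i) (s ∷ τ)) (cong (f i ∷_)
          (trans (cleared-suc a id s τ) (cong (s ∷_) (cleared-all τ)))))
        (runs-clear a scratch (f i ∷ s ∷ τ)))
      (runs-≤ t≤ (runs-embed s r))

  -- Loops over lists and counters.

  module _ {I : Set ℓ} {μ : I → ℕ} {A : I → Set} {enc : ∀ i → A i → Tree} (xs : ∀ i → List (A i)) where

    private
      Positions = Σ I λ i → Position (xs i)

    -- The step is indexed by a position, but its time is measured by `μ` of the outer index alone.
    -- All iterations thus share one bound, however large the accumulator becomes.
    foldlᶜ : PolyBounded μ (length ∘ xs) → (acc : ∀ i → List (A i) → Tree) →
             _⊢_⟶_ {I = Positions} (μ ∘ proj₁) (λ (i , p) → enc i (current p) ∙ acc i (passed p))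
                                               (λ (i , p) → acc i (current p ∷ passed p)) →
             μ ⊢ (λ i → codeList (enc i) (xs i) ∙ acc i []) ⟶ (λ i → acc i (reverse (xs i)))
    foldlᶜ len≤ acc F = record
      { cmd   = while hdᵉ v₀ ⟨ body′ ⟩ ⨾ (zero ≔ tlᵉ v₀)
      ; bound = λ i → 7 + length (xs i) * total i
      ; poly  = pb-+ (pb-const 7) (pb-* len≤ poly-total)
      ; run   = λ i s τ → let τ′ , r = go i [] (xs i) refl s τ in
          τ′ , runs-≤ (s≤s (≤-reflexive (trans (+-assoc _ 3 3) (+-comm _ 6)))) (runs-seq r runs-assign)
      }
      where
      -- The rest of the list waits on the stack while `F` works on the current element and the
      -- accumulator.
      body′ : Cmd (2 + a)
      body′ = (suc zero ≔ consᵉ (tlᵉ (hdᵉ v₀)) v₁) ⨾ (zero ≔ consᵉ (hdᵉ (hdᵉ v₀)) (tlᵉ v₀)) ⨾ cmd F ⨾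
              (zero ≔ consᵉ (hdᵉ v₁) v₀) ⨾ (suc zero ≔ tlᵉ v₁)
      c = proj₁ (poly F)
      k = proj₁ (proj₂ (poly F))
      bodyBound total : I → ℕ
      -- The polynomial itself is used instead of `bound F`, whose value may vary with the position.
      bodyBound i = c * suc (μ i) ^ k
      total i = 19 + (bodyBound i + 9)
      poly-total : PolyBounded μ total
      poly-total = pb-+ (pb-const 19) (pb-+ (pb-* (pb-const c) (pb-^ (pb-suc pb-self) k)) (pb-const 9))
      go : ∀ i ps ys → ps ʳ++ ys ≡ xs i → ∀ s τ → ∃ λ τ′ →
           Runs (while hdᵉ v₀ ⟨ body′ ⟩) ((codeList (enc i) ys ∙ acc i ps) ∷ s ∷ τ) (length ys * total i + 3)
                ((nil ∙ acc i (reverse (xs i))) ∷ s ∷ τ′)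
      go i ps []       eq s τ = τ ,
        subst (λ qs → Runs (while hdᵉ v₀ ⟨ body′ ⟩) ((nil ∙ acc i ps) ∷ s ∷ τ) 3 ((nil ∙ acc i qs) ∷ s ∷ τ))
              (trans (sym (List.reverse-involutive ps)) (cong reverse eq)) (runs-stop refl)
      go i ps (y ∷ ys) eq  s τ =
        let τ₁ , r₁ = run F (i , position ps y ys eq) (codeList (enc i) ys ∙ s) τ
            τ₂ , r₂ = go i (y ∷ ps) ys eq s τ₁ in
        τ₂ , runs-≤ (≤-reflexive (cong (19 +_) (sym (+-assoc (bodyBound i + 9) (length ys * total i) 3))))
          (runs-loop (λ ()) (runs-seq runs-assign (runs-seq runs-assign (runs-seq
            (runs-≤ (proj₂ (proj₂ (poly F)) _) r₁) (runs-seq runs-assign runs-assign)))) r₂)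

  module _ {I : Set ℓ} {μ : I → ℕ} {A : I → Set} {enc : ∀ i → A i → Tree} (xs : ∀ i → List (A i)) where

    foldrᶜ : ∀ {f : I → Tree} → PolyBounded μ (length ∘ xs) → μ ⊢ f ⟶ (λ i → codeList (enc i) (xs i)) →
             (r : ∀ i → List (A i) → Tree) → μ ⊢ f ⟶ (λ i → r i []) →
             _⊢_⟶_ {I = Σ I (Position ∘ xs)} (μ ∘ proj₁) (λ (i , p) → enc i (current p) ∙ (f i ∙ r i (remaining p)))
                                               (λ (i , p) → r i (current p ∷ remaining p)) →
             μ ⊢ f ⟶ (λ i → r i (xs i))
    foldrᶜ {f} len≤ L r base step =
      -- The first left fold reverses the list, the second runs the steps. The value `f i` travels
      -- in the accumulator so that each step can consult it.
      ⟪ ⟪ L , expr nilᵉ (λ _ _ _ → refl) ⟫ ≫ foldlᶜ xs len≤ (λ i → codeList (enc i)) idᶜ , ⟪ idᶜ , base ⟫ ⟫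
      ≫ foldlᶜ (reverse ∘ xs) (pb-mono (λ i → ≤-reflexive (List.length-reverse (xs i))) len≤)
               (λ i ps → f i ∙ r i ps) (keeping (reindex (λ (i , p) → i , mirror p) step))
      ≫ dropᶜ
      ≡ᶜ λ i → cong (r i) (List.reverse-involutive (xs i))

  module _ {I : Set ℓ} {μ : I → ℕ} {k : I → ℕ} (k≤ : PolyBounded μ k) where

    -- The counter is the number of list elements that remain in a right fold. It occurs only in the
    -- index, and `l < k i` lets the step bound quantities that depend on `l`.
    iterateᶜ : ∀ {f : I → Tree} → μ ⊢ f ⟶ (num ∘ k) →
               (g : I → ℕ → Tree) → μ ⊢ f ⟶ (λ i → g i 0) →
               _⊢_⟶_ {I = Σ I λ i → ∃ λ l → l < k i} (μ ∘ proj₁)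
                     (λ (i , l , _) → f i ∙ g i l) (λ (i , l , _) → g i (suc l)) →
               μ ⊢ f ⟶ (λ i → g i (k i))
    iterateᶜ K g base step =
      foldrᶜ {enc = λ _ _ → nil} (λ i → List.replicate (k i) tt)
        (pb-mono (λ i → ≤-reflexive (List.length-replicate (k i))) k≤)
        (K ≡ᶜ λ i → num-codeList (k i))
        (λ i ys → g i (length ys)) base
        (dropᶜ ≫ reindex (λ (i , p) → i , length (remaining p) ,
                            subst (length (remaining p) <_) (List.length-replicate (k i)) (remaining<length p)) step)
      ≡ᶜ λ i → cong (g i) (List.length-replicate (k i))

  -- Decision procedures and their logical combinations.

  infix 3 _⊢_⊩_
  record _⊢_⊩_ {I : Set ℓ} (μ : I → ℕ) (f : I → Tree) (P : I → Set) : Set ℓ where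
    field
      decide   : I → Bool
      computes : μ ⊢ f ⟶ (codeBool ∘ decide)
      correct  : ∀ i → T (decide i) ⇔ P i

  open _⊢_⊩_ public

  module _ {I : Set ℓ} {μ : I → ℕ} where

    mapᵈ : ∀ {f P Q} → (∀ i → P i ⇔ Q i) → μ ⊢ f ⊩ P → μ ⊢ f ⊩ Q
    mapᵈ P⇔Q D = record
      { decide = decide D ; computes = computes D ; correct = λ i → ⇔.trans (correct D i) (P⇔Q i) }

    infixr 4 _≫ᵈ_
    _≫ᵈ_ : ∀ {f g P} → μ ⊢ f ⟶ g → μ ⊢ g ⊩ P → μ ⊢ f ⊩ P
    F ≫ᵈ D = record { decide = decide D ; computes = F ≫ computes D ; correct = correct D }

    truthyᵈ : ∀ {f g} → μ ⊢ f ⟶ g → μ ⊢ f ⊩ (λ i → T (truthy (g i)))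
    truthyᵈ {f} {g} F = record
      { decide   = λ i → truthy (g i)
      -- Every tree other than nil counts as true, so the value is normalised to the code of a
      -- Boolean.
      ; computes = ⟪ F , expr (consᵉ (consᵉ nilᵉ nilᵉ) nilᵉ) (λ _ _ _ → refl) ⟫ ≫ select
                   ≡ᶜ λ i → normal (g i)
      ; correct  = λ _ → ⇔.refl
      }
      where
      normal : ∀ x → (if truthy x then codeBool true else codeBool false) ≡ codeBool (truthy x)
      normal nil     = refl
      normal (_ ∙ _) = refl

    ifᶜ_then_else_ : ∀ {f g h P} → (D : μ ⊢ f ⊩ P) → μ ⊢ f ⟶ g → μ ⊢ f ⟶ h →
                     μ ⊢ f ⟶ (λ i → if decide D i then g i else h i)
    ifᶜ_then_else_ {g = g} {h} D G H = ⟪ computes D , ⟪ G , H ⟫ ⟫ ≫ select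
      ≡ᶜ λ i → cong (if_then g i else h i) (truthy-codeBool (decide D i))

    falseᶜ : ∀ {f} → μ ⊢ f ⟶ (λ _ → codeBool false)
    falseᶜ = expr nilᵉ λ _ _ _ → refl

    trueᶜ : ∀ {f} → μ ⊢ f ⟶ (λ _ → codeBool true)
    trueᶜ = expr (consᵉ nilᵉ nilᵉ) λ _ _ _ → refl

    ⊤ᵈ : ∀ {f} → μ ⊢ f ⊩ (λ _ → ⊤)
    ⊤ᵈ = record { decide = λ _ → true ; computes = trueᶜ ; correct = λ _ → ⇔.refl }

    ¬ᵈ_ : ∀ {f P} → μ ⊢ f ⊩ P → μ ⊢ f ⊩ (λ i → ¬ P i)
    ¬ᵈ_ {f} {P} D = record
      { decide   = not ∘ decide D
      ; computes = ifᶜ D then falseᶜ else trueᶜ ≡ᶜ λ i → go (decide D i)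
      ; correct  = λ i → go′ (decide D i) (correct D i)
      }
      where
      go : ∀ b → (if b then codeBool false else codeBool true) ≡ codeBool (not b)
      go false = refl
      go true  = refl
      go′ : ∀ b {P} → T b ⇔ P → T (not b) ⇔ (¬ P)
      go′ false e = mk⇔ (λ _ → from e) _
      go′ true  e = mk⇔ (λ ()) (λ ¬p → ¬p (to e _))

    _×ᵈ_ : ∀ {f P Q} → μ ⊢ f ⊩ P → μ ⊢ f ⊩ Q → μ ⊢ f ⊩ (λ i → P i × Q i)
    D ×ᵈ E = record
      { decide   = λ i → decide D i ∧ decide E i
      ; computes = ifᶜ D then computes E else falseᶜ ≡ᶜ λ i → go (decide D i)
      ; correct  = λ i → go′ (decide D i) (correct D i) (correct E i)
      }
      where
      go : ∀ b {c} → (if b then codeBool c else codeBool false) ≡ codeBool (b ∧ c)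
      go false = refl
      go true  = refl
      go′ : ∀ b {c P Q} → T b ⇔ P → T c ⇔ Q → T (b ∧ c) ⇔ (P × Q)
      go′ false e e′ = mk⇔ (λ ()) (λ (p , _) → from e p)
      go′ true  e e′ = mk⇔ (λ c → to e _ , to e′ c) (λ (_ , q) → from e′ q)

    _⊎ᵈ_ : ∀ {f P Q} → μ ⊢ f ⊩ P → μ ⊢ f ⊩ Q → μ ⊢ f ⊩ (λ i → P i ⊎ Q i)
    D ⊎ᵈ E = record
      { decide   = λ i → decide D i ∨ decide E i
      ; computes = ifᶜ D then trueᶜ else computes E ≡ᶜ λ i → go (decide D i)
      ; correct  = λ i → go′ (decide D i) (correct D i) (correct E i)
      }
      where
      go : ∀ b {c} → (if b then codeBool true else codeBool c) ≡ codeBool (b ∨ c)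
      go false = refl
      go true  = refl
      go′ : ∀ b {c P Q} → T b ⇔ P → T c ⇔ Q → T (b ∨ c) ⇔ (P ⊎ Q)
      go′ false e e′ = mk⇔ (inj₂ ∘ to e′)
        (λ { (inj₁ p) → contradiction (from e p) λ () ; (inj₂ q) → from e′ q })
      go′ true  e e′ = mk⇔ (λ _ → inj₁ (to e _)) _

    any-Finᵈ : ∀ {f p} {P : Fin p → I → Set} → (∀ j → μ ⊢ f ⊩ P j) → μ ⊢ f ⊩ (λ i → ∃ λ j → P j i)
    any-Finᵈ {p = zero}  D = mapᵈ (λ _ → mk⇔ (λ t → contradiction tt t) (λ ())) (¬ᵈ ⊤ᵈ)
    any-Finᵈ {p = suc p} D = mapᵈ
      (λ _ → mk⇔ (λ { (inj₁ x) → zero , x ; (inj₂ (j , x)) → suc j , x })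
                 (λ { (zero , x) → inj₁ x ; (suc j , x) → inj₂ (j , x) }))
      (D zero ⊎ᵈ any-Finᵈ (D ∘ suc))

    all-Finᵈ : ∀ {f p} {P : Fin p → I → Set} → (∀ j → μ ⊢ f ⊩ P j) → μ ⊢ f ⊩ (λ i → ∀ j → P j i)
    all-Finᵈ {p = zero}  D = mapᵈ (λ _ → mk⇔ (λ _ ()) (λ _ → tt)) ⊤ᵈ
    all-Finᵈ {p = suc p} D = mapᵈ
      (λ _ → mk⇔ (λ { (x , xs) zero → x ; (x , xs) (suc j) → xs j }) (λ xs → xs zero , xs ∘ suc))
      (D zero ×ᵈ all-Finᵈ (D ∘ suc))

  reindexᵈ : ∀ {I : Set ℓ} {μ : I → ℕ} {J : Set ℓ} (h : J → I) {f P} → μ ⊢ f ⊩ P → (μ ∘ h) ⊢ (f ∘ h) ⊩ (P ∘ h)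
  reindexᵈ h D = record
    { decide = decide D ∘ h ; computes = reindex h (computes D) ; correct = correct D ∘ h }

-- Vertices, graphs and thresholds as trees

T-injective : ∀ {b c} → T b ⇔ T c → b ≡ c
T-injective {false} {false} e = refl
T-injective {false} {true}  e = contradiction (from e tt) λ ()
T-injective {true}  {false} e = contradiction (to e tt) λ ()
T-injective {true}  {true}  e = refl

codeList-cong : ∀ {A : Set} {f g : A → Tree} → f ≗ g → codeList f ≗ codeList g
codeList-cong f≗g []       = refl
codeList-cong f≗g (x ∷ xs) = cong₂ _∙_ (f≗g x) (codeList-cong f≗g xs)

any⇔∃ : ∀ {n} (b : Fin n → Bool) → T (any b (allFin n)) ⇔ ∃ (T ∘ b)
any⇔∃ {n} b = go id
  where
  go : ∀ {m} (h : Fin m → Fin n) → T (any b (tabulate h)) ⇔ ∃ (T ∘ b ∘ h)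
  go {zero}  h = mk⇔ (λ ()) (λ ())
  go {suc m} h with b (h zero) in eq
  ... | true  = mk⇔ (λ _ → zero , subst T (sym eq) tt) _
  ... | false = mk⇔ (λ t → let j , x = to (go (h ∘ suc)) t in suc j , x)
                    λ { (zero , x)  → contradiction (subst T eq x) λ ()
                      ; (suc j , x) → from (go (h ∘ suc)) (j , x) }

tails : ℕ → Tree → Tree
tails zero    x = x
tails (suc k) x = tl (tails k x)

tails-tl : ∀ k x → tails k (tl x) ≡ tl (tails k x)
tails-tl zero    x = refl
tails-tl (suc k) x = cong tl (tails-tl k x)

-- After `k` tails the numeral of `l` has become that of the truncated difference of `l` and `k`,
-- which is nonzero exactly for `k < l`.
tails-num : ∀ k l → T (truthy (tails k (num l))) ⇔ k < l
tails-num zero    zero    = mk⇔ (λ ()) (λ ())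
tails-num zero    (suc l) = mk⇔ (λ _ → s≤s z≤n) _
tails-num (suc k) zero    = mk⇔ (λ t → contradiction t (subst (¬_ ∘ T ∘ truthy) (sym (tails-nil (suc k))) id)) (λ ())
  where
  tails-nil : ∀ k → tails k nil ≡ nil
  tails-nil zero    = refl
  tails-nil (suc k) = cong tl (tails-nil k)
tails-num (suc k) (suc l) = ⇔.trans
  (subst (λ x → T (truthy x) ⇔ (k < l)) (tails-tl k (num (suc l))) (tails-num k l))
  (mk⇔ s≤s λ { (s≤s k<l) → k<l })

hd-tails : ∀ {n} (f : Fin n → Tree) u → hd (tails (toℕ u) (codeList f (allFin n))) ≡ f u
hd-tails {n} f = go id
  where
  go : ∀ {m} (h : Fin m → Fin n) u → hd (tails (toℕ u) (codeList f (tabulate h))) ≡ f (h u)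
  go h zero    = refl
  go h (suc u) = trans (cong hd (sym (tails-tl (toℕ u) _))) (go (h ∘ suc) u)

codeGraph-allFin : ∀ G → codeGraph G ≡
  codeList (λ u → codeList (λ v → codeBool (adj G u v)) (allFin (order G))) (allFin (order G))
codeGraph-allFin G = trans (codeList-tabulate (codeList codeBool) _)
                           (codeList-cong (λ u → codeList-tabulate codeBool _) (allFin (order G)))

nums : ℕ → ℕ → Tree
nums j zero    = nil
nums j (suc l) = num j ∙ nums (suc j) l

nums-verts : ∀ n → nums 0 n ≡ verts n
nums-verts n = go 0 id λ _ → refl
  where
  go : ∀ j {m} (h : Fin m → Fin n) → (∀ v → j + toℕ v ≡ toℕ (h v)) → nums j m ≡ codeList vert (tabulate h)
  go j {zero}  h eq = refl
  go j {suc m} h eq = cong₂ _∙_ (cong num (trans (sym (+-identityʳ j)) (eq zero)))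
                                (go (suc j) (h ∘ suc) (λ v → trans (sym (+-suc j (toℕ v))) (eq (suc v))))

-- Bijective binary numerals.

bits : ℕᵇ → List Bool
bits ℕᵇ.zero  = []
bits 1+[2 x ] = false ∷ bits x
bits 2[1+ x ] = true ∷ bits x

codeℕᵇ-bits : ∀ x → codeℕᵇ x ≡ codeList codeBool (bits x)
codeℕᵇ-bits ℕᵇ.zero  = refl
codeℕᵇ-bits 1+[2 x ] = cong (_ ∙_) (codeℕᵇ-bits x)
codeℕᵇ-bits 2[1+ x ] = cong (_ ∙_) (codeℕᵇ-bits x)

-- Here `false` is the digit 1 and `true` the digit 2, so that a 2 turns into a 1 with a carry.
increment : List Bool → List Bool
increment []           = false ∷ []
increment (false ∷ bs) = true ∷ bs
increment (true ∷ bs)  = false ∷ increment bs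

bits-suc : ∀ x → bits (ℕᵇ.suc x) ≡ increment (bits x)
bits-suc ℕᵇ.zero  = refl
bits-suc 1+[2 x ] = refl
bits-suc 2[1+ x ] = cong (false ∷_) (bits-suc x)

bitsOf : ℕ → List Bool
bitsOf zero    = []
bitsOf (suc n) = increment (bitsOf n)

codeℕ-bitsOf : ∀ n → codeℕ n ≡ codeList codeBool (bitsOf n)
codeℕ-bitsOf n = trans (cong codeℕᵇ (fromℕ≡fromℕ' n)) (trans (codeℕᵇ-bits _) (cong (codeList codeBool) (go n)))
  where
  go : ∀ n → bits (fromℕ' n) ≡ bitsOf n
  go zero    = refl
  go (suc n) = trans (bits-suc (fromℕ' n)) (cong increment (go n))

-- This crude bound suffices, since the numbers to be converted are themselves polynomially bounded.
length-bitsOf : ∀ n → length (bitsOf n) ≤ n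
length-bitsOf zero    = z≤n
length-bitsOf (suc n) = ≤-trans (length-increment (bitsOf n)) (s≤s (length-bitsOf n))
  where
  length-increment : ∀ bs → length (increment bs) ≤ suc (length bs)
  length-increment []           = ≤-refl
  length-increment (false ∷ bs) = n≤1+n _
  length-increment (true ∷ bs)  = s≤s (length-increment bs)

-- Sizes of codes.

size-codeList : ∀ {A : Set} {f : A → Tree} {b} → (∀ x → size (f x) ≤ b) →
                ∀ xs → size (codeList f xs) ≤ suc (length xs * suc b)
size-codeList f≤ []       = ≤-refl
size-codeList f≤ (x ∷ xs) = s≤s (≤-trans (+-mono-≤ (f≤ x) (size-codeList f≤ xs)) (≤-reflexive (+-suc _ _)))

length≤size : ∀ {A : Set} (f : A → Tree) xs → length xs ≤ size (codeList f xs)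
length≤size f []       = z≤n
length≤size f (x ∷ xs) = s≤s (≤-trans (length≤size f xs) (m≤n+m _ (size (f x))))

size-codeBool : ∀ b → size (codeBool b) ≤ 3
size-codeBool false = s≤s z≤n
size-codeBool true  = ≤-refl

size-codeℕ : ∀ n → size (codeℕ n) ≤ suc (n * 4)
size-codeℕ n = begin
  size (codeℕ n)                          ≡⟨ cong size (codeℕ-bitsOf n) ⟩
  size (codeList codeBool (bitsOf n))     ≤⟨ size-codeList size-codeBool (bitsOf n) ⟩
  suc (length (bitsOf n) * 4)             ≤⟨ s≤s (*-monoˡ-≤ 4 (length-bitsOf n)) ⟩
  suc (n * 4)                             ∎
  where open ≤-Reasoning

size-codeGraph : ∀ G → size (codeGraph G) ≤ suc (order G * suc (suc (order G * 4)))
size-codeGraph G = begin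
  size (codeGraph G)                            ≡⟨ cong size (codeGraph-allFin G) ⟩
  size (codeList _ (allFin n))                  ≤⟨ size-codeList (λ u → size-codeList (λ v → size-codeBool (adj G u v)) (allFin n))
                                                                (allFin n) ⟩
  suc (length (allFin n) * suc (suc (length (allFin n) * 4)))
                                                ≡⟨ cong (λ l → suc (l * suc (suc (l * 4)))) (List.length-tabulate {n = n} id) ⟩
  suc (n * suc (suc (n * 4)))                   ∎
  where
  open ≤-Reasoning
  n = order G

order≤size : ∀ G → order G ≤ size (codeGraph G)
order≤size G = subst (_≤ size (codeGraph G)) (List.length-tabulate _) (length≤size (codeList codeBool) _)

pb-reindex : ∀ {I J : Set ℓ} {μ k : I → ℕ} (h : J → I) → PolyBounded μ k → PolyBounded (μ ∘ h) (k ∘ h)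
pb-reindex h (c , e , k≤) = c , e , k≤ ∘ h

toℕ≤ : ∀ {I : Set ℓ} {μ n : I → ℕ} → PolyBounded μ n → (u : ∀ i → Fin (n i)) → PolyBounded μ (λ i → toℕ (u i))
toℕ≤ n≤ u = pb-mono (λ i → <⇒≤ (Fin.toℕ<n (u i))) n≤

-- Loops over vertices and operations on adjacency matrices.

module Vertices (a : ℕ) where

  open Language a

  module _ {I : Set ℓ} {μ : I → ℕ} {f : I → Tree} where

    module _ {n : I → ℕ} (n≤ : PolyBounded μ n) (V : μ ⊢ f ⟶ (verts ∘ n)) where

      private
        length≤ : PolyBounded μ (λ i → length (allFin (n i)))
        length≤ = pb-mono (λ i → ≤-reflexive (List.length-tabulate {n = n i} id)) n≤

      -- The body is tested for every vertex, the environment being extended by the vertex in front.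
      ∃ᵈ : {P : Σ I (Fin ∘ n) → Set} →
           (μ ∘ proj₁) ⊢ (λ (i , v) → vert v ∙ f i) ⊩ P → μ ⊢ f ⊩ (λ i → ∃ λ v → P (i , v))
      ∃ᵈ D = record
        { decide   = λ i → any (λ v → decide D (i , v)) (allFin (n i))
        ; computes = foldrᶜ (λ i → allFin (n i)) length≤ V
            (λ i vs → codeBool (any (λ v → decide D (i , v)) vs)) falseᶜ
            (ifᶜ expr (consᵉ (hdᵉ v₀) (hdᵉ (tlᵉ v₀))) (λ _ _ _ → refl) ≫ᵈ reindexᵈ (λ (i , p) → i , current p) D
             then trueᶜ else (dropᶜ ≫ dropᶜ)
             ≡ᶜ λ (i , p) → disjoin (decide D (i , current p)))
        ; correct  = λ i → ⇔.trans (any⇔∃ _)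
            (mk⇔ (λ (v , t) → v , to (correct D (i , v)) t)
                 (λ (v , p) → v , from (correct D (i , v)) p))
        }
        where
        disjoin : ∀ b {c} → (if b then codeBool true else codeBool c) ≡ codeBool (b ∨ c)
        disjoin false = refl
        disjoin true  = refl

      mapVertsᶜ : ∀ {g : ∀ i → Fin (n i) → Tree} →
                  (μ ∘ proj₁) ⊢ (λ (i , v) → vert v ∙ f i) ⟶ (λ (i , v) → g i v) →
                  μ ⊢ f ⟶ (λ i → codeList (g i) (allFin (n i)))
      mapVertsᶜ {g} G = foldrᶜ (λ i → allFin (n i)) length≤ V (λ i → codeList (g i)) falseᶜ
        ⟪ expr (consᵉ (hdᵉ v₀) (hdᵉ (tlᵉ v₀))) (λ _ _ _ → refl) ≫ reindex (λ (i , p) → i , current p) G , dropᶜ ≫ dropᶜ ⟫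

    tailsᶜ : ∀ {k x} → PolyBounded μ k → μ ⊢ f ⟶ (num ∘ k) → μ ⊢ f ⟶ x → μ ⊢ f ⟶ (λ i → tails (k i) (x i))
    tailsᶜ {x = x} k≤ K X = iterateᶜ k≤ K (λ i l → tails l (x i)) X (expr (tlᵉ (tlᵉ v₀)) λ _ _ _ → refl)

    <ᵈ : ∀ {k l} → PolyBounded μ k → μ ⊢ f ⟶ (num ∘ k) → μ ⊢ f ⟶ (num ∘ l) → μ ⊢ f ⊩ (λ i → k i < l i)
    <ᵈ k≤ K L = mapᵈ (λ _ → tails-num _ _) (truthyᵈ (tailsᶜ k≤ K L))

    module _ {n : I → ℕ} (n≤ : PolyBounded μ n) where

      ≡ᵈ : ∀ {u v : ∀ i → Fin (n i)} → μ ⊢ f ⟶ (λ i → vert (u i)) → μ ⊢ f ⟶ (λ i → vert (v i)) →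
           μ ⊢ f ⊩ (λ i → u i ≡ v i)
      ≡ᵈ {u} {v} U V = mapᵈ
        (λ i → mk⇔ (λ (u≮v , v≮u) → Fin.toℕ-injective (≤-antisym (≮⇒≥ v≮u) (≮⇒≥ u≮v)))
                   (λ u≡v → n≮n _ ∘ subst (λ w → toℕ w < toℕ (v i)) u≡v , n≮n _ ∘ subst (λ w → toℕ (v i) < toℕ w) u≡v))
        ((¬ᵈ <ᵈ (toℕ≤ n≤ u) U V) ×ᵈ (¬ᵈ <ᵈ (toℕ≤ n≤ v) V U))

      nthᶜ : ∀ {u : ∀ i → Fin (n i)} {enc : ∀ i → Fin (n i) → Tree} → μ ⊢ f ⟶ (λ i → vert (u i)) →
             μ ⊢ f ⟶ (λ i → codeList (enc i) (allFin (n i))) → μ ⊢ f ⟶ (λ i → enc i (u i))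
      nthᶜ {u} {enc} U L = tailsᶜ (toℕ≤ n≤ u) U L ≫ expr (hdᵉ v₀) (λ _ _ _ → refl)
        ≡ᶜ λ i → hd-tails (enc i) (u i)

    codeℕᶜ : ∀ {k} → PolyBounded μ k → μ ⊢ f ⟶ (num ∘ k) → μ ⊢ f ⟶ (codeℕ ∘ k)
    codeℕᶜ {k} k≤ K = iterateᶜ k≤ K (λ i l → codeList codeBool (bitsOf l)) falseᶜ (dropᶜ ≫
        foldrᶜ {enc = λ _ → codeBool} (λ (i , l , _) → bitsOf l)
          (pb-mono (λ (i , l , l<k) → ≤-trans (length-bitsOf l) (<⇒≤ l<k)) (pb-reindex proj₁ k≤))
          -- Each digit list is carried together with its increment: where no carry occurs, the next
          -- increment needs the unchanged list.
          idᶜ (λ i bs → codeList codeBool bs ∙ codeList codeBool (increment bs))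
          (expr (consᵉ nilᵉ (consᵉ nilᵉ nilᵉ)) λ _ _ _ → refl)
          (⟪ expr (consᵉ (hdᵉ v₀) (hdᵉ (tlᵉ (tlᵉ v₀)))) (λ _ _ _ → refl)
           , expr (consᵉ (hdᵉ v₀) (consᵉ (consᵉ nilᵉ (tlᵉ (tlᵉ (tlᵉ v₀)))) (consᵉ (consᵉ nilᵉ nilᵉ) (hdᵉ (tlᵉ (tlᵉ v₀))))))
                  (λ _ _ _ → refl)
             ≫ select
           ⟫ ≡ᶜ λ (_ , p) → cong (codeList codeBool (current p ∷ remaining p) ∙_) (step (current p) (remaining p)))
        ≫ dropᶜ)
      ≡ᶜ λ i → sym (codeℕ-bitsOf (k i))
      where
      step : ∀ b bs → (if truthy (codeBool b) then codeBool false ∙ codeList codeBool (increment bs)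
                       else codeBool true ∙ codeList codeBool bs)
                      ≡ codeList codeBool (increment (b ∷ bs))
      step false bs = refl
      step true  bs = refl

  underᶜ : ∀ {I : Set ℓ} {μ : I → ℕ} {X : I → Set} {f g : I → Tree} {y : Σ I X → Tree} →
           μ ⊢ f ⟶ g → (μ ∘ proj₁) ⊢ (λ j → y j ∙ f (proj₁ j)) ⟶ (g ∘ proj₁)
  underᶜ F = dropᶜ ≫ reindex proj₁ F

  firstᶜ : ∀ {I : Set ℓ} {μ : I → ℕ} {f g : I → Tree} → μ ⊢ (λ i → f i ∙ g i) ⟶ f
  firstᶜ = expr (hdᵉ v₀) λ _ _ _ → refl

  secondᶜ : ∀ {I : Set ℓ} {μ : I → ℕ} {f g h : I → Tree} → μ ⊢ (λ i → f i ∙ (g i ∙ h i)) ⟶ g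
  secondᶜ = dropᶜ ≫ firstᶜ

  module _ {I : Set ℓ} {μ : I → ℕ} {f : I → Tree} (G : I → Graph) (n≤ : PolyBounded μ (order ∘ G)) where

    codeGraphᶜ : μ ⊢ f ⟶ (verts ∘ order ∘ G) →
                 _⊢_⊩_ {I = Σ (Σ I (Vertex ∘ G)) (Vertex ∘ G ∘ proj₁)} (μ ∘ proj₁ ∘ proj₁)
                       (λ ((i , u) , v) → vert v ∙ (vert u ∙ f i)) (λ ((i , u) , v) → Adj (G i) u v) →
                 μ ⊢ f ⟶ (codeGraph ∘ G)
    codeGraphᶜ V D =
      mapVertsᶜ n≤ V (mapVertsᶜ (pb-reindex proj₁ n≤) (underᶜ V)
        (computes D ≡ᶜ λ j → cong codeBool (T-injective (correct D j))))
      ≡ᶜ λ i → sym (codeGraph-allFin (G i))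

    Adjᵈ : ∀ {u v : ∀ i → Vertex (G i)} → μ ⊢ f ⟶ (codeGraph ∘ G) →
           μ ⊢ f ⟶ (λ i → vert (u i)) → μ ⊢ f ⟶ (λ i → vert (v i)) → μ ⊢ f ⊩ (λ i → Adj (G i) (u i) (v i))
    Adjᵈ {u} {v} M U V = mapᵈ (λ i → subst (λ b → T (truthy (codeBool (adj (G i) (u i) (v i)))) ⇔ T b) (truthy-codeBool _) ⇔.refl)
      (truthyᵈ (nthᶜ n≤ {v} V (nthᶜ n≤ {u} {enc = λ i u → codeList (λ v → codeBool (adj (G i) u v)) (allFin _)} U
        (M ≡ᶜ λ i → codeGraph-allFin (G i)))))

    -- Counting the rows gives the order. The list is then built from the last vertex downwards,
    -- beside a numeral that starts at the order and is decremented before each vertex is prepended.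
    vertsᶜ : μ ⊢ f ⟶ (codeGraph ∘ G) → μ ⊢ f ⟶ (verts ∘ order ∘ G)
    vertsᶜ M = ⟪ idᶜ , orderᶜ ⟫
      ≫ iterateᶜ n≤ dropᶜ (λ i l → num (order (G i) ∸ l) ∙ nums (order (G i) ∸ l) l)
          (expr (consᵉ (tlᵉ v₀) nilᵉ) λ _ _ _ → refl)
          (expr (consᵉ (tlᵉ (hdᵉ (tlᵉ v₀))) (consᵉ (tlᵉ (hdᵉ (tlᵉ v₀))) (tlᵉ (tlᵉ v₀)))) (λ _ _ _ → refl)
           ≡ᶜ λ (i , l , l<n) → prepend l (sym (+-∸-assoc 1 l<n)))
      ≫ dropᶜ
      ≡ᶜ λ i → trans (cong (λ j → nums j (order (G i))) (n∸n≡0 (order (G i)))) (nums-verts (order (G i)))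
      where
      rows : ∀ i → List (List Bool)
      rows i = tabulate λ u → tabulate λ v → adj (G i) u v
      orderᶜ : μ ⊢ f ⟶ (num ∘ order ∘ G)
      orderᶜ = foldrᶜ rows (pb-mono (λ i → ≤-reflexive (List.length-tabulate {n = order (G i)} _)) n≤) M
        (λ i ys → num (length ys)) falseᶜ (expr (consᵉ nilᵉ (tlᵉ (tlᵉ v₀))) λ _ _ _ → refl)
        ≡ᶜ λ i → cong num (List.length-tabulate {n = order (G i)} _)
      prepend : ∀ l {j k} → suc j ≡ k → tl (num k) ∙ (tl (num k) ∙ nums k l) ≡ num j ∙ nums j (suc l)
      prepend l refl = refl

-- Decidability and least numbers.

T-does : ∀ {A : Set} (A? : Dec A) → T (does A?) ⇔ A
T-does (yes a) = mk⇔ (λ _ → a) _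
T-does (no ¬a) = mk⇔ (λ ()) ¬a

T-not : ∀ {b} → T (not b) ⇔ (¬ T b)
T-not {false} = mk⇔ (λ _ ()) _
T-not {true}  = mk⇔ (λ ()) (λ ¬t → ¬t tt)

module _ {P : ℕ → Set} (P? : Decidable P) where

  minimum : ∀ {n} → P n → ∃ λ m → IsMinimum P m × m ≤ n
  minimum {n} pn = [ (λ (m , m<n , min) → m , min , <⇒≤ m<n) ,
                     (λ none → n , (pn , λ j pj → ≮⇒≥ λ j<n → none j j<n pj) , ≤-refl) ]′ (below n)
    where
    below : ∀ n → (∃ λ m → m < n × IsMinimum P m) ⊎ (∀ j → j < n → ¬ P j)
    below zero = inj₂ λ _ ()
    below (suc n) with below n
    ... | inj₁ (m , m<n , min) = inj₁ (m , m<n⇒m<1+n m<n , min)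
    ... | inj₂ none with P? n
    ...   | yes p = inj₁ (n , ≤-refl , p , λ j pj → ≮⇒≥ λ j<n → none j j<n pj)
    ...   | no ¬p = inj₂ λ j j<1+n pj → [ (λ j<n → none j j<n pj) , (λ { refl → ¬p pj }) ]′ (m≤n⇒m<n∨m≡n (≤-pred j<1+n))

minimum-unique : ∀ {P : ℕ → Set} {m n} → IsMinimum P m → IsMinimum P n → m ≡ n
minimum-unique (pm , m≤) (pn , n≤) = ≤-antisym (m≤ _ pn) (n≤ _ pm)

anyVec? : ∀ {n} q {P : Vec (Fin n) q → Set} → Decidable P → Dec (∃ P)
anyVec? zero    P? = Dec.map′ ([] ,_) (λ { ([] , p) → p }) (P? [])
anyVec? (suc q) P? = Dec.map′ (λ (u , us , p) → u ∷ us , p) (λ { (u ∷ us , p) → u , us , p })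
                              (Fin.any? λ u → anyVec? q λ us → P? (u ∷ us))

-- Finite subsets

∣insert∣ : ∀ {n} (S : Subset n) x → ∣ S [ x ]≔ inside ∣ ≤ suc ∣ S ∣
∣insert∣ (outside ∷ S) zero    = ≤-refl
∣insert∣ (inside ∷ S)  zero    = n≤1+n _
∣insert∣ (outside ∷ S) (suc x) = ∣insert∣ S x
∣insert∣ (inside ∷ S)  (suc x) = s≤s (∣insert∣ S x)

∈-insert : ∀ {n} (S : Subset n) x → x ∈ S [ x ]≔ inside
∈-insert = Vec.[]≔-updates

⊆-insert : ∀ {n} (S : Subset n) x → S Subset.⊆ (S [ x ]≔ inside)
⊆-insert S x {y} y∈S with y Fin.≟ x
... | yes refl = ∈-insert S x
... | no y≢x   = Vec.[]≔-minimal S y x y≢x y∈S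

members : ∀ {n} (S : Subset n) → ∃ λ (xs : Vec (Fin n) ∣ S ∣) → ∀ {v} → v ∈ S → ∃ λ l → v ≡ lookup xs l
members []            = [] , λ ()
members (outside ∷ S) = let xs , all = members S in
  Vec.map suc xs , λ { (there v∈S) → let l , eq = all v∈S in l , trans (cong suc eq) (sym (Vec.lookup-map l suc xs)) }
members (inside ∷ S)  = let xs , all = members S in
  zero ∷ Vec.map suc xs , λ
    { here        → zero , refl
    ; (there v∈S) → let l , eq = all v∈S in suc l , trans (cong suc eq) (sym (Vec.lookup-map l suc xs)) }

-- The entries of a tuple may coincide, hence only an upper bound on the size.
fromVec : ∀ {n q} (xs : Vec (Fin n) q) → ∃ λ S → ∣ S ∣ ≤ q × ∀ l → lookup xs l ∈ S
fromVec {n} []   = Subset.⊥ , ≤-reflexive (Subset.∣⊥∣≡0 n) , λ ()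
fromVec (x ∷ xs) = let S , ∣S∣≤ , ∈S = fromVec xs in
  S [ x ]≔ inside , ≤-trans (∣insert∣ S x) (s≤s ∣S∣≤) ,
  λ { zero → ∈-insert S x ; (suc l) → ⊆-insert S x (∈S l) }

-- Domination

HasDominating : Graph → ℕ → Set
HasDominating G k = ∃ λ S → IsDominating G S × ∣ S ∣ ≤ k

module _ (G : Graph) where

  isDominating? : Decidable (IsDominating G)
  isDominating? S = Fin.all? λ v → (v Subset.∈? S) ⊎-dec (Fin.any? λ u → (u Subset.∈? S) ×-dec T? (adj G v u))

  -- Domination is decidable, so the least size of a dominating set can be found by search once one
  -- such set is known.
  γ≤⇔ : ∀ {k} → γ[ G ]≤ k ⇔ HasDominating G k
  γ≤⇔ {k} = mk⇔
    (λ { (_ , ((S , dom , refl) , _) , ∣S∣≤k) → S , dom , ∣S∣≤k })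
    (λ (S , dom , ∣S∣≤k) →
      let m , min , m≤∣S∣ = minimum (λ n → Subset.anySubset? λ S → isDominating? S ×-dec (∣ S ∣ ≟ n)) (S , dom , refl) in
      m , min , ≤-trans m≤∣S∣ ∣S∣≤k)

  γ≤? : ∀ k → Dec (γ[ G ]≤ k)
  γ≤? k = Dec.map (⇔.sym γ≤⇔) (Subset.anySubset? λ S → isDominating? S ×-dec (∣ S ∣ ≤? k))

  γ≤-mono : ∀ {k l} → k ≤ l → γ[ G ]≤ k → γ[ G ]≤ l
  γ≤-mono k≤l (m , min , m≤k) = m , min , ≤-trans m≤k k≤l

  γ≤order : γ[ G ]≤ order G
  γ≤order = from γ≤⇔ (Subset.⊤ , (λ v → inj₁ Subset.∈⊤) , Subset.∣p∣≤n (Subset.⊤ {order G}))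

  dominationNumber : ∃ (IsDominationNumber G)
  dominationNumber = let m , min , _ = γ≤order in m , min

  -- A set of at most `k` vertices is listed by a tuple of some length `q` up to `k`. For fixed `k`
  -- there are only polynomially many such tuples.
  γ≤-tuple : ∀ {k} → γ[ G ]≤ k ⇔
    (∃ λ (q : Fin (suc k)) → ∃ λ (xs : Vec (Vertex G) (toℕ q)) →
      ∀ v → ∃ λ l → v ≡ lookup xs l ⊎ Adj G v (lookup xs l))
  γ≤-tuple {k} = ⇔.trans γ≤⇔ (mk⇔ tuple set)
    where
    Tuple : ℕ → Set
    Tuple q = ∃ λ (xs : Vec (Vertex G) q) → ∀ v → ∃ λ l → v ≡ lookup xs l ⊎ Adj G v (lookup xs l)
    tuple : HasDominating G k → ∃ λ (q : Fin (suc k)) → Tuple (toℕ q)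
    tuple (S , dom , ∣S∣≤k) = fromℕ< (s≤s ∣S∣≤k) , subst Tuple (sym (Fin.toℕ-fromℕ< (s≤s ∣S∣≤k)))
      (let xs , all = members S in xs , λ v →
        [ (λ v∈S → let l , v≡ = all v∈S in l , inj₁ v≡)
        , (λ (u , u∈S , vu) → let l , u≡ = all u∈S in l , inj₂ (subst (Adj G v) u≡ vu)) ]′ (dom v))
    set : (∃ λ (q : Fin (suc k)) → Tuple (toℕ q)) → HasDominating G k
    set (q , xs , dom) = let S , ∣S∣≤ , ∈S = fromVec xs in
      S , (λ v → let l , d = dom v in
             [ (λ v≡ → inj₁ (subst (_∈ S) (sym v≡) (∈S l))) , (λ vx → inj₂ (lookup xs l , ∈S l , vx)) ]′ d) ,
      ≤-trans ∣S∣≤ (≤-pred (Fin.toℕ<n q))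

-- Subgraphs and edge deletion.

graph : ∀ n (A : Fin n → Fin n → Bool) → (∀ u v → A u v ≡ A v u) → (∀ v → A v v ≡ false) → Graph
graph n A s i = record { order = n ; adj = A ; adj-sym = s ; adj-irrefl = i }

-- Additional edges keep a dominating set dominating. Both graphs are given by matrices on a common
-- `n`, so no transport between vertex sets arises.
γ≤-⊆ : ∀ {n} {A : Fin n → Fin n → Bool} {s i} {B : Fin n → Fin n → Bool} {s′ i′} →
       (∀ u v → T (A u v) → T (B u v)) → ∀ {k} → γ[ graph n A s i ]≤ k → γ[ graph n B s′ i′ ]≤ k
γ≤-⊆ {n} {A} {s} {i} {B} {s′} {i′} A⊆B γ≤k = let S , dom , ∣S∣≤k = to (γ≤⇔ (graph n A s i)) γ≤k in
  from (γ≤⇔ (graph n B s′ i′)) (S , (λ v → Sum.map₂ (λ (u , u∈S , vu) → u , u∈S , A⊆B v u vu) (dom v)) , ∣S∣≤k)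

T-joins : ∀ {n} E (u v : Fin n) → T (joins E u v) ⇔ ((u , v) ∈ˡ E ⊎ (v , u) ∈ˡ E)
T-joins E u v = ⇔.trans (T-∨ {does uv?} {does vu?})
  (mk⇔ (Sum.map (to (T-does uv?)) (to (T-does vu?))) (Sum.map (from (T-does uv?)) (from (T-does vu?))))
  where
  open DecMembership _≟ᵖ_ using (_∈?_)
  uv? = (u , v) ∈? E
  vu? = (v , u) ∈? E

module _ (G : Graph) where

  adj-─ : ∀ E {u v} → Adj (G ─ E) u v ⇔ (Adj G u v × ¬ ((u , v) ∈ˡ E ⊎ (v , u) ∈ˡ E))
  adj-─ E {u} {v} = ⇔.trans T-∧ (mk⇔
    (λ (uv , ¬j) → uv , to T-not ¬j ∘ from (T-joins E u v))
    (λ (uv , ¬j) → uv , from T-not (¬j ∘ to (T-joins E u v))))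

  γ≤-─-mono : ∀ E E′ → (∀ {u v} → Adj (G ─ E) u v → Adj (G ─ E′) u v) → ∀ {k} → γ[ G ─ E ]≤ k → γ[ G ─ E′ ]≤ k
  γ≤-─-mono E E′ sub = γ≤-⊆ {s = adj-sym (G ─ E)} {adj-irrefl (G ─ E)} {s′ = adj-sym (G ─ E′)} {adj-irrefl (G ─ E′)}
                            λ _ _ → sub

  adj-─-∷ : ∀ e E {u v} → Adj (G ─ (e ∷ E)) u v ⇔ (Adj (G ─ E) u v × ¬ ((u , v) ≡ e ⊎ (v , u) ≡ e))
  adj-─-∷ e E = ⇔.trans (adj-─ (e ∷ E)) (mk⇔
    (λ (uv , ¬j) → from (adj-─ E) (uv , ¬j ∘ Sum.map there there) , ¬j ∘ Sum.map here here)
    (λ (uv , ¬e) → let uv′ , ¬j = to (adj-─ E) uv in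
      uv′ , λ { (inj₁ (here eq)) → ¬e (inj₁ eq) ; (inj₁ (there j)) → ¬j (inj₁ j)
              ; (inj₂ (here eq)) → ¬e (inj₂ eq) ; (inj₂ (there j)) → ¬j (inj₂ j) }))

  adj-─-[] : ∀ {u v} → Adj (G ─ []) u v ⇔ Adj G u v
  adj-─-[] = ⇔.trans (adj-─ []) (mk⇔ proj₁ (λ uv → uv , λ { (inj₁ ()) ; (inj₂ ()) }))

  -- Only one end of the deleted pair has to be added to the set: if `a` is in it, then only `b` can
  -- lose its dominator; if not, then only `a` can.
  γ≤-delete : ∀ e E {k} → γ[ G ─ E ]≤ k → γ[ G ─ (e ∷ E) ]≤ suc k
  γ≤-delete e@(a , b) E {k} γ≤k with to (γ≤⇔ (G ─ E)) γ≤k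
  ... | S , dom , ∣S∣≤k = repair (a Subset.∈? S)
    where
    repaired : ∀ x → (∀ u v → u ∈ S → (v , u) ≡ e ⊎ (u , v) ≡ e → v ∈ S [ x ]≔ inside) → γ[ G ─ (e ∷ E) ]≤ suc k
    repaired x ends = from (γ≤⇔ (G ─ (e ∷ E))) (S [ x ]≔ inside , dom′ , ≤-trans (∣insert∣ S x) (s≤s ∣S∣≤k))
      where
      dom′ : IsDominating (G ─ (e ∷ E)) (S [ x ]≔ inside)
      dom′ v with dom v
      ... | inj₁ v∈S = inj₁ (⊆-insert S x v∈S)
      ... | inj₂ (u , u∈S , vu) with ((v , u) ≟ᵖ e) ⊎-dec ((u , v) ≟ᵖ e)
      ...   | yes vu≡e = inj₁ (ends u v u∈S vu≡e)
      ...   | no  vu≢e = inj₂ (u , ⊆-insert S x u∈S , from (adj-─-∷ e E) (vu , vu≢e))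
    repair : Dec (a ∈ S) → γ[ G ─ (e ∷ E) ]≤ suc k
    repair (yes a∈S) = repaired b λ { u v u∈S (inj₁ refl) → ⊆-insert S b a∈S ; u v u∈S (inj₂ refl) → ∈-insert S b }
    repair (no a∉S)  = repaired a λ { u v u∈S (inj₁ refl) → ∈-insert S a ; u v u∈S (inj₂ refl) → contradiction u∈S a∉S }

  -- Arbitrary pairs are what a program can enumerate, whereas bondage speaks of edge sets. Pairs
  -- without effect are dropped and the ends of the others are put in increasing order.
  normalise : ∀ E → ∃ λ E′ → IsEdgeSet G E′ × length E′ ≤ length E ×
                             (∀ {u v} → Adj (G ─ E) u v ⇔ Adj (G ─ E′) u v)
  normalise [] = [] , ([] , []) , z≤n , ⇔.refl
  normalise (e@(a , b) ∷ E) with normalise E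
  ... | E′ , (isEdge , unique) , len≤ , same with T? (adj (G ─ E′) a b)
  -- This case covers loops, non-edges and pairs already deleted in either orientation.
  ...   | no ¬ab = E′ , (isEdge , unique) , m≤n⇒m≤1+n len≤ , ⇔.trans (adj-─-∷ e E) (mk⇔
            (λ (uv , _) → to same uv)
            (λ uv → from same uv , λ { (inj₁ refl) → ¬ab uv ; (inj₂ refl) → ¬ab (subst T (adj-sym (G ─ E′) b a) uv) }))
  ...   | yes ab with Fin.<-cmp a b | to (adj-─ E′) ab
  ...     | tri< a<b _ _ | ab′ , ∉E′ =
            e ∷ E′ , ((a<b , ab′) ∷ isEdge , All.¬Any⇒All¬ E′ (∉E′ ∘ inj₁) ∷ unique) , s≤s len≤ ,
            ⇔.trans (adj-─-∷ e E) (⇔.trans (mk⇔ (λ (uv , ¬e) → to same uv , ¬e) (λ (uv , ¬e) → from same uv , ¬e))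
              (⇔.sym (adj-─-∷ e E′)))
  ...     | tri≈ _ refl _ | ab′ , _ = contradiction (subst T (adj-irrefl G a) ab′) λ ()
  ...     | tri> _ _ b<a | ab′ , ∉E′ =
            (b , a) ∷ E′ , ((b<a , subst T (adj-sym G a b) ab′) ∷ isEdge , All.¬Any⇒All¬ E′ (∉E′ ∘ inj₂) ∷ unique) , s≤s len≤ ,
            ⇔.trans (adj-─-∷ e E) (⇔.trans
              (mk⇔ (λ (uv , ¬e) → to same uv , ¬e ∘ [ inj₂ ∘ flipped , inj₁ ∘ flipped ]′)
                   (λ (uv , ¬e) → from same uv , ¬e ∘ [ inj₂ ∘ flipped , inj₁ ∘ flipped ]′))
              (⇔.sym (adj-─-∷ (b , a) E′)))
    where
    flipped : ∀ {u v a b : Vertex G} → (u , v) ≡ (a , b) → (v , u) ≡ (b , a)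
    flipped refl = refl

-- Bondage

-- The pairs are stored as one flat tuple, with the ends of pair `j` at places `2j` and `2j + 1`, so
-- that they are enumerated like any tuple of vertices.
edges : ∀ {A : Set} p → Vec A (p * 2) → List (A × A)
edges p w = List.tabulate λ (j : Fin p) → lookup w (combine j zero) , lookup w (combine j (suc zero))

edges-surjective : ∀ {A : Set} (E : List (A × A)) → ∃ λ w → edges (length E) w ≡ E
edges-surjective []            = [] , refl
edges-surjective ((u , v) ∷ E) = let w , eq = edges-surjective E in u ∷ v ∷ w , cong ((u , v) ∷_) eq

-- A threshold between the two domination numbers replaces their comparison, so that only questions
-- of the form γ ≤ k have to be answered.
Increases : (G : Graph) → List (Vertex G × Vertex G) → Set
Increases G E = ∃ λ k → γ[ G ]≤ k × ¬ γ[ G ─ E ]≤ k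

IncreasesBy : Graph → ℕ → Set
IncreasesBy G p = ∃ λ (w : Vec (Vertex G) (p * 2)) → Increases G (edges p w)

BondageSet : Graph → ℕ → Set
BondageSet G n = ∃ λ E → IsEdgeSet G E × length E ≡ n ×
  ∃ λ m → IsDominationNumber G m × IsDominationNumber (G ─ E) (m + 1)

exact : ∀ G {m} → γ[ G ]≤ suc m → ¬ γ[ G ]≤ m → IsDominationNumber G (m + 1)
exact G {m} (m′ , min , m′≤) γ≰m = subst (IsDominationNumber G)
  (trans (≤-antisym m′≤ (≰⇒> λ m′≤m → γ≰m (m′ , min , m′≤m))) (+-comm 1 m)) min

module _ (G : Graph) where

  bondageSet⇒increases : ∀ {n} → BondageSet G n → ∃ λ E → length E ≡ n × Increases G E
  bondageSet⇒increases (E , _ , len , m , min , min′) = E , len , m , (m , min , ≤-refl) ,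
    λ (m′ , min″ , m′≤m) → n≮n m (≤-trans (≤-reflexive (trans (+-comm 1 m) (minimum-unique min′ min″))) m′≤m)

  -- Deleting the edges of E one at a time raises γ by at most one at each
  -- step, so the value γ(G) + 1 is attained on the way.
  increases⇒bondageSet : ∀ E → Increases G E → ∃ λ n → n ≤ length E × BondageSet G n
  increases⇒bondageSet E (k , γ≤k , γ≰k) = go E (γ≰k ∘ γ≤-mono (G ─ E) (let _ , _ , m≤k = γ≤k in m≤k))
    where
    m : ℕ
    m = proj₁ γ≤k
    min : IsDominationNumber G m
    min = proj₁ (proj₂ γ≤k)
    go : ∀ E → ¬ γ[ G ─ E ]≤ m → ∃ λ n → n ≤ length E × BondageSet G n
    go [] γ≰m = contradiction (γ≤-⊆ {s = adj-sym G} {adj-irrefl G} {s′ = adj-sym (G ─ [])} {adj-irrefl (G ─ [])}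
                                    (λ _ _ → from (adj-─-[] G)) (m , min , ≤-refl)) γ≰m
    go (e ∷ E) γ≰m with γ≤? (G ─ E) m
    ... | no γ≰m′ = let n , n≤ , set = go E γ≰m′ in n , m≤n⇒m≤1+n n≤ , set
    ... | yes γ≤m = let E′ , isSet , len≤ , same = normalise G (e ∷ E) in
      length E′ , len≤ , E′ , isSet , refl , m , min ,
      exact (G ─ E′) (γ≤-─-mono G (e ∷ E) E′ (to same) (γ≤-delete G e E γ≤m))
                     (γ≰m ∘ γ≤-─-mono G E′ (e ∷ E) (from same))

  increases? : Decidable (Increases G)
  increases? E = let m , min = dominationNumber G in Dec.map′
    (λ γ≰m → m , (m , min , ≤-refl) , γ≰m)
    (λ { (k , (m′ , min′ , m′≤k) , γ≰k) γ≤m → γ≰k (γ≤-mono (G ─ E) (subst (_≤ k) (minimum-unique min′ min) m′≤k) γ≤m) })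
    (Dec.¬? (γ≤? (G ─ E) m))

  -- The threshold can be taken to be γ(G), which is at most `K`.
  increases-bounded : ∀ E {K} → γ[ G ]≤ K → Increases G E ⇔
    (∃ λ (k : Fin (suc K)) → γ[ G ]≤ toℕ k × ¬ γ[ G ─ E ]≤ toℕ k)
  increases-bounded E {K} (m , min , m≤K) = mk⇔
    (λ (k , (m′ , min′ , m′≤k) , γ≰k) → fromℕ< (s≤s m≤K) ,
      subst (λ k → γ[ G ]≤ k × ¬ γ[ G ─ E ]≤ k) (sym (Fin.toℕ-fromℕ< (s≤s m≤K)))
        ((m , min , ≤-refl) , γ≰k ∘ γ≤-mono (G ─ E) (subst (_≤ k) (minimum-unique min′ min) m′≤k)))
    (λ (k , γ≤k , γ≰k) → toℕ k , γ≤k , γ≰k)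

  -- Dominating Set admits only positive thresholds, and these are indexed by vertices so as to be
  -- searched by a vertex loop. Threshold 0 would make the graph empty, where deletion changes
  -- nothing; every number from the order on bounds γ(G - E).
  increases-threshold : ∀ E → Increases G E ⇔
    (∃ λ (j : Vertex G) → γ[ G ]≤ suc (toℕ j) × ¬ γ[ G ─ E ]≤ suc (toℕ j))
  increases-threshold E = mk⇔ threshold (λ (j , γ≤k , γ≰k) → suc (toℕ j) , γ≤k , γ≰k)
    where
    γ≤0 : γ[ G ]≤ 0 → γ[ G ─ E ]≤ 0
    γ≤0 γ≤0 = let S , dom , ∣S∣≤0 = to (γ≤⇔ G) γ≤0 in
      from (γ≤⇔ (G ─ E)) (S , (λ v → contradiction (member (dom v)) (empty S ∣S∣≤0)) , ∣S∣≤0)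
      where
      member : ∀ {S v} → v ∈ S ⊎ (∃ λ u → u ∈ S × Adj G v u) → ∃ (_∈ S)
      member = [ (λ v∈S → _ , v∈S) , (λ (u , u∈S , _) → u , u∈S) ]′
      empty : ∀ {n} (S : Subset n) → ∣ S ∣ ≤ 0 → ¬ ∃ (_∈ S)
      empty S ∣S∣≤0 (v , v∈S) = n≮0 (<-≤-trans (Subset.x∈p⇒∣p-x∣<∣p∣ v∈S) ∣S∣≤0)
    threshold : Increases G E → ∃ λ (j : Vertex G) → γ[ G ]≤ suc (toℕ j) × ¬ γ[ G ─ E ]≤ suc (toℕ j)
    threshold (zero , γ≤k , γ≰k) = contradiction (γ≤0 γ≤k) γ≰k
    threshold (suc k , γ≤k , γ≰k) = fromℕ< k<n ,
      subst (λ k → γ[ G ]≤ suc k × ¬ γ[ G ─ E ]≤ suc k) (sym (Fin.toℕ-fromℕ< k<n)) (γ≤k , γ≰k)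
      where
      k<n : k < order G
      k<n = ≰⇒> λ n≤k → γ≰k (γ≤-mono (G ─ E) (m≤n⇒m≤1+n n≤k) (γ≤order (G ─ E)))

  increasesBy : ∀ {d} E → length E ≤ d → Increases G E → ∃ λ (p : Fin (suc d)) → IncreasesBy G (toℕ p)
  increasesBy E len≤ inc = fromℕ< (s≤s len≤) , subst (IncreasesBy G) (sym (Fin.toℕ-fromℕ< (s≤s len≤)))
    (let w , eq = edges-surjective E in w , subst (Increases G) (sym eq) inc)

  -- For the converse, take the least `n` such that some list of at most `n` pairs increases γ. Such
  -- a list yields a bondage set of size at most `n`, and by leastness its size is `n`.
  bondage⇔ : ∀ {d} → b[ G ]≤ d ⇔ (∃ λ (p : Fin (suc d)) → IncreasesBy G (toℕ p))
  bondage⇔ {d} = mk⇔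
    (λ (n , (set , _) , n≤d) → let E , len , inc = bondageSet⇒increases set in
      increasesBy E (≤-trans (≤-reflexive len) n≤d) inc)
    (λ inc → let n , (inc′ , least) , n≤d = minimum (λ n → Fin.any? {suc n} λ p → anyVec? (toℕ p * 2) λ w →
                                                       increases? (edges (toℕ p) w)) inc
                 n′ , n′≤n , set = small inc′
                 n≡n′ = ≤-antisym (least n′ (large set)) n′≤n in
      n , (subst (BondageSet G) (sym n≡n′) set , λ l set′ → least l (large set′)) , n≤d)
    where
    large : ∀ {n} → BondageSet G n → ∃ λ (p : Fin (suc n)) → IncreasesBy G (toℕ p)
    large set = let E , len , inc = bondageSet⇒increases set in increasesBy E (≤-reflexive len) inc
    small : ∀ {n} → (∃ λ (p : Fin (suc n)) → IncreasesBy G (toℕ p)) → ∃ λ n′ → n′ ≤ n × BondageSet G n′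
    small (p , w , inc) = let n′ , n′≤ , set = increases⇒bondageSet (edges (toℕ p) w) inc in
      n′ , ≤-trans n′≤ (≤-trans (≤-reflexive (List.length-tabulate _)) (≤-pred (Fin.toℕ<n p))) , set

closed-─ : ∀ {C : Pred Graph ℓ} → ClosedUnderEdgeDeletion C → ∀ G → C G → ∀ E →
           ∃ λ A → ∃ λ s → ∃ λ i → C (graph (order G) A s i) × ∀ u v → A u v ≡ adj (G ─ E) u v
closed-─ {C = C} closed G G∈C E = let E′ , (isEdge , unique) , _ , same = normalise G E
                                      A , s , i , A∈C , A≡ = go E′ isEdge unique in
  A , s , i , A∈C , λ u v → trans (A≡ u v) (T-injective (⇔.sym same))
  where
  go : ∀ E → All (IsEdge G) E → Unique E →
       ∃ λ A → ∃ λ s → ∃ λ i → C (graph (order G) A s i) × ∀ u v → A u v ≡ adj (G ─ E) u v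
  go [] _ _ = adj G , adj-sym G , adj-irrefl G , G∈C , λ u v → T-injective (⇔.sym (adj-─-[] G))
  go (e@(a , b) ∷ E) ((a<b , ab) ∷ isEdge) (e∉E ∷ unique) with go E isEdge unique
  ... | A , s , i , A∈C , A≡ = adj K′ , adj-sym K′ , adj-irrefl K′ , closed K A∈C e (a<b , subst T (sym (A≡ a b)) ab′) , λ u v →
      T-injective (⇔.trans (adj-─-∷ K e []) (⇔.trans (same u v) (⇔.sym (adj-─-∷ G e E))))
    where
    K = graph (order G) A s i
    K′ = K ─ (e ∷ [])
    ab′ : Adj (G ─ E) a b
    -- The pair `e` is still an edge: `E` does not contain it by uniqueness, nor its reversal,
    -- because the ends are in increasing order.
    ab′ = from (adj-─ G E) (ab , [ All.All¬⇒¬Any e∉E , (λ ba∈E → <-asym a<b (proj₁ (lookupAll isEdge ba∈E))) ]′)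
    same : ∀ u v {X : Set} → (Adj (K ─ []) u v × X) ⇔ (Adj (G ─ E) u v × X)
    same u v = mk⇔ (λ (uv , x) → subst T (A≡ u v) (to (adj-─-[] K) uv) , x)
                   (λ (uv , x) → from (adj-─-[] K) (subst T (sym (A≡ u v)) uv) , x)

codeGraph-cong : ∀ {n} {A : Fin n → Fin n → Bool} {s i} {B : Fin n → Fin n → Bool} {s′ i′} →
                 (∀ u v → A u v ≡ B u v) → codeGraph (graph n A s i) ≡ codeGraph (graph n B s′ i′)
codeGraph-cong A≡B = cong (codeList (codeList codeBool)) (List.tabulate-cong λ u → List.tabulate-cong (A≡B u))

-- Pendant vertices

leaf : (G : Graph) → Vertex G → Graph
leaf G x = graph (suc (order G)) A s i
  where
  A : Fin (suc (order G)) → Fin (suc (order G)) → Bool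
  A zero    zero    = false
  A zero    (suc v) = does (x Fin.≟ v)
  A (suc u) zero    = does (x Fin.≟ u)
  A (suc u) (suc v) = adj G u v
  s : ∀ u v → A u v ≡ A v u
  s zero    zero    = refl
  s zero    (suc v) = refl
  s (suc u) zero    = refl
  s (suc u) (suc v) = adj-sym G u v
  i : ∀ v → A v v ≡ false
  i zero    = refl
  i (suc v) = adj-irrefl G v

attach : (G : Graph) → ∀ {q} → Vec (Vertex G) q → Graph
attach G []       = G
attach G (x ∷ xs) = attach (leaf G x) (Vec.map suc xs)

order-attach : ∀ G {q} (xs : Vec (Vertex G) q) → order (attach G xs) ≡ q + order G
order-attach G []                = refl
order-attach G {suc q} (x ∷ xs) = trans (order-attach (leaf G x) (Vec.map suc xs)) (+-suc q (order G))

HasDominating⊇ : (G : Graph) → ∀ {q} → Vec (Vertex G) q → ℕ → Set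
HasDominating⊇ G xs k = ∃ λ S → IsDominating G S × ∣ S ∣ ≤ k × ∀ j → lookup xs j ∈ S

-- A pendant vertex is dominated only by itself or by `x`, and exchanging it for `x` in a dominating
-- set costs nothing.
leaf-dominating : ∀ G x {q} (xs : Vec (Vertex G) q) {k} →
                  HasDominating⊇ (leaf G x) (Vec.map suc xs) k ⇔ HasDominating⊇ G (x ∷ xs) k
leaf-dominating G x xs {k} = mk⇔ remove add
  where
  xs∈ : ∀ {b S} → (∀ j → lookup (Vec.map suc xs) j ∈ (b ∷ S)) → ∀ j → lookup xs j ∈ S
  xs∈ xs∈S j with subst (_∈ _) (Vec.lookup-map j suc xs) (xs∈S j)
  ... | there x∈S = x∈S
  restrict : ∀ {b S S′} → IsDominating (leaf G x) (b ∷ S) → S Subset.⊆ S′ → x ∈ S′ → IsDominating G S′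
  restrict dom S⊆S′ x∈S′ v with dom (suc v)
  ... | inj₁ (there v∈S)              = inj₁ (S⊆S′ v∈S)
  ... | inj₂ (zero , _ , vx)          = inj₁ (subst (_∈ _) (to (T-does (x Fin.≟ v)) vx) x∈S′)
  ... | inj₂ (suc u , there u∈S , vu) = inj₂ (u , S⊆S′ u∈S , vu)
  remove : HasDominating⊇ (leaf G x) (Vec.map suc xs) k → HasDominating⊇ G (x ∷ xs) k
  remove (inside ∷ S , dom , ∣S∣≤k , xs∈S) =
    S [ x ]≔ inside , restrict dom (⊆-insert S x) (∈-insert S x) , ≤-trans (∣insert∣ S x) ∣S∣≤k ,
    λ { zero → ∈-insert S x ; (suc j) → ⊆-insert S x (xs∈ xs∈S j) }
  remove (outside ∷ S , dom , ∣S∣≤k , xs∈S) with dom zero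
  -- The pendant vertex is outside the set, so its only neighbour `x` is inside.
  ... | inj₂ (suc u , there u∈S , xu) with refl ← to (T-does (x Fin.≟ u)) xu =
    S , restrict dom id u∈S , ∣S∣≤k , λ { zero → u∈S ; (suc j) → xs∈ xs∈S j }
  add : HasDominating⊇ G (x ∷ xs) k → HasDominating⊇ (leaf G x) (Vec.map suc xs) k
  add (S , dom , ∣S∣≤k , xs∈S) = outside ∷ S , dom′ , ∣S∣≤k ,
      λ j → subst (_∈ (outside ∷ S)) (sym (Vec.lookup-map j suc xs)) (there (xs∈S (suc j)))
    where
    dom′ : IsDominating (leaf G x) (outside ∷ S)
    dom′ zero    = inj₂ (suc x , there (xs∈S zero) , from (T-does (x Fin.≟ x)) refl)
    dom′ (suc v) = Sum.map there (λ (u , u∈S , vu) → suc u , there u∈S , vu) (dom v)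

γ≤-attach : ∀ G {q} (xs : Vec (Vertex G) q) {k} → γ[ attach G xs ]≤ k ⇔ HasDominating⊇ G xs k
γ≤-attach G [] = ⇔.trans (γ≤⇔ G) (mk⇔ (λ (S , dom , ∣S∣≤k) → S , dom , ∣S∣≤k , λ ())
                                      (λ (S , dom , ∣S∣≤k , _) → S , dom , ∣S∣≤k))
γ≤-attach G (x ∷ xs) = ⇔.trans (γ≤-attach (leaf G x) (Vec.map suc xs)) (leaf-dominating G x xs)

-- Domination after deletion by way of guards.

Guards : (G : Graph) → ∀ p → (w xs : Vec (Vertex G) (p * 2)) → Set
Guards G p w xs = ∀ j → lookup w j ≡ lookup xs j ⊎ Adj (G ─ edges p w) (lookup w j) (lookup xs j)

-- Vertices outside `w` keep all their edges, and the entries of `w` are dominated by their guards,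
-- which the pendant vertices force into the set. Conversely, a dominating set of the smaller graph
-- provides the guards.
γ≤-guards : ∀ G p w {k} → γ[ G ─ edges p w ]≤ k ⇔ (∃ λ xs → Guards G p w xs × γ[ attach G xs ]≤ k)
γ≤-guards G p w {k} = ⇔.trans (γ≤⇔ (G ─ E)) (mk⇔ guess check)
  where
  E = edges p w
  guess : HasDominating (G ─ E) k → ∃ λ xs → Guards G p w xs × γ[ attach G xs ]≤ k
  guess (S , dom , ∣S∣≤k) = xs , (λ j → subst (Guarded j) (sym (Vec.lookup∘tabulate _ j)) (proj₂ (proj₂ (guard j)))) ,
      from (γ≤-attach G xs) (S , (λ v → Sum.map₂ (λ (u , u∈S , vu) → u , u∈S , proj₁ (to (adj-─ G E) vu)) (dom v)) , ∣S∣≤k ,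
        λ j → subst (_∈ S) (sym (Vec.lookup∘tabulate _ j)) (proj₁ (proj₂ (guard j))))
    where
    Guarded : Fin (p * 2) → Vertex G → Set
    Guarded j x = lookup w j ≡ x ⊎ Adj (G ─ E) (lookup w j) x
    guard : ∀ j → ∃ λ x → x ∈ S × Guarded j x
    guard j = [ (λ w∈S → lookup w j , w∈S , inj₁ refl) , (λ (u , u∈S , wu) → u , u∈S , inj₂ wu) ]′ (dom (lookup w j))
    xs = Vec.tabulate (proj₁ ∘ guard)
  check : (∃ λ xs → Guards G p w xs × γ[ attach G xs ]≤ k) → HasDominating (G ─ E) k
  check (xs , guards , γ≤k) with to (γ≤-attach G xs) γ≤k
  ... | S , dom , ∣S∣≤k , xs∈S = S , dom′ , ∣S∣≤k
    where
    dom′ : IsDominating (G ─ E) S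
    dom′ v with Fin.any? (λ j → v Fin.≟ lookup w j) | dom v
    ... | yes (j , refl) | _ = [ (λ w≡x → inj₁ (subst (_∈ S) (sym w≡x) (xs∈S j))) , (λ wx → inj₂ (lookup xs j , xs∈S j , wx)) ]′ (guards j)
    ... | no _     | inj₁ v∈S = inj₁ v∈S
    ... | no v∉w   | inj₂ (u , u∈S , vu) = inj₂ (u , u∈S , from (adj-─ G E) (vu ,
            [ (λ vu∈E → let j , eq = ∈-tabulate⁻ vu∈E in v∉w (combine j zero , ,-injectiveˡ eq))
            , (λ uv∈E → let j , eq = ∈-tabulate⁻ uv∈E in v∉w (combine j (suc zero) , ,-injectiveʳ eq)) ]′))

-- Induced copies and pendant vertices.

some : ∀ {n} (b : Fin n → Bool) → 1 ≤ ∣ Vec.tabulate b ∣ → ∃ (T ∘ b)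
some {suc n} b 1≤ with b zero in eq
... | true  = zero , subst T (sym eq) tt
... | false = let u , bu = some (b ∘ suc) 1≤ in suc u , bu

two : ∀ {n} (b : Fin n → Bool) → 2 ≤ ∣ Vec.tabulate b ∣ → ∃ λ u → ∃ λ v → u ≢ v × T (b u) × T (b v)
two {suc n} b 2≤ with b zero in eq
... | true  = let v , bv = some (b ∘ suc) (≤-pred 2≤) in zero , suc v , (λ ()) , subst T (sym eq) tt , bv
... | false = let u , v , u≢v , bu , bv = two (b ∘ suc) 2≤ in suc u , suc v , u≢v ∘ Fin.suc-injective , bu , bv

module _ {H : Graph} (2≤degree : ∀ a → 2 ≤ degree H a) where

  -- If a copy of `H` used the pendant vertex, two distinct neighbours in `H` of its preimage would
  -- both be mapped to `x`.
  leaf-free : ∀ G x → Free H G → Free H (leaf G x)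
  leaf-free G x free (f , f-injective , f-adj) = free ((λ a → proj₁ (old a)) ,
      (λ {a} {b} eq → f-injective (trans (proj₂ (old a)) (trans (cong suc eq) (sym (proj₂ (old b)))))) ,
      λ a b → trans (cong₂ (adj (leaf G x)) (sym (proj₂ (old a))) (sym (proj₂ (old b)))) (f-adj a b))
    where
    toLeaf : ∀ v → T (adj (leaf G x) zero v) → v ≡ suc x
    toLeaf (suc v) xv = cong suc (sym (to (T-does (x Fin.≟ v)) xv))
    old : ∀ a → ∃ λ v → f a ≡ suc v
    old a with f a in eq
    ... | suc v = v , refl
    ... | zero  = let b , c , b≢c , ab , ac = two (adj H a) (2≤degree a) in
      contradiction (f-injective (trans (at-x b ab) (sym (at-x c ac)))) b≢c
      where
      at-x : ∀ b → Adj H a b → f b ≡ suc x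
      at-x b ab = toLeaf (f b) (subst (λ v → T (adj (leaf G x) v (f b))) eq (subst T (sym (f-adj a b)) ab))

  attach-free : ∀ G {q} (xs : Vec (Vertex G) q) → Free H G → Free H (attach G xs)
  attach-free G []       free = free
  attach-free G (x ∷ xs) free = attach-free (leaf G x) (Vec.map suc xs) (leaf-free G x free)

-- Algorithms

-- The entries are pushed onto an environment `x`, as nested vertex loops leave them.
tuple : ∀ {n q} → Vec (Fin n) q → Tree → Tree
tuple []       x = x
tuple (v ∷ vs) x = vert v ∙ tuple vs x

tails-tuple : ∀ {n q} (vs : Vec (Fin n) q) x → tails q (tuple vs x) ≡ x
tails-tuple         []       x = refl
tails-tuple {q = suc q} (v ∷ vs) x = trans (sym (tails-tl q _)) (tails-tuple vs x)

hd-tails-tuple : ∀ {n q} (vs : Vec (Fin n) q) x j → hd (tails (toℕ j) (tuple vs x)) ≡ vert (lookup vs j)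
hd-tails-tuple (v ∷ vs) x zero    = refl
hd-tails-tuple (v ∷ vs) x (suc j) = trans (cong hd (sym (tails-tl (toℕ j) _))) (hd-tails-tuple vs x j)

codeGraph-leaf : ∀ G x → codeGraph (leaf G x) ≡
  (nil ∙ codeList (λ v → codeBool (does (x Fin.≟ v))) (allFin (order G))) ∙
  codeList (λ u → codeBool (does (x Fin.≟ u)) ∙ codeList (λ v → codeBool (adj G u v)) (allFin (order G))) (allFin (order G))
codeGraph-leaf G x = cong₂ _∙_ (cong (nil ∙_) (codeList-tabulate codeBool _))
  (trans (codeList-tabulate (codeList codeBool) _)
         (codeList-cong (λ u → cong (codeBool (does (x Fin.≟ u)) ∙_) (codeList-tabulate codeBool _)) (allFin (order G))))

-- The list of vertices is kept beside the matrix because every vertex loop runs over it.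
base : Graph → Tree
base G = verts (order G) ∙ codeGraph G

joined⇔ : ∀ {n} p (w : Vec (Fin n) (p * 2)) {u v} →
  ((u , v) ∈ˡ edges p w ⊎ (v , u) ∈ˡ edges p w) ⇔
  (∃ λ j → (u ≡ lookup w (combine j zero) × v ≡ lookup w (combine j (suc zero))) ⊎
           (v ≡ lookup w (combine j zero) × u ≡ lookup w (combine j (suc zero))))
joined⇔ p w = mk⇔
  [ (λ uv∈ → let j , eq = ∈-tabulate⁻ uv∈ in j , inj₁ (,-injectiveˡ eq , ,-injectiveʳ eq))
  , (λ vu∈ → let j , eq = ∈-tabulate⁻ vu∈ in j , inj₂ (,-injectiveˡ eq , ,-injectiveʳ eq)) ]′
  λ { (j , inj₁ (refl , refl)) → inj₁ (∈-tabulate⁺ j) ; (j , inj₂ (refl , refl)) → inj₂ (∈-tabulate⁺ j) }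

module Algorithms (a : ℕ) where

  open Language a
  open Vertices a

  module _ {I : Set ℓ} {μ : I → ℕ} where

    -- The number of tails is fixed here, so they are written out in the expression and no loop is
    -- run.
    tailsᵉ : ℕ → Expr (2 + a)
    tailsᵉ zero    = v₀
    tailsᵉ (suc q) = tlᵉ (tailsᵉ q)

    eval-tailsᵉ : ∀ q x {s τ} → eval (tailsᵉ q) (x ∷ s ∷ τ) ≡ tails q x
    eval-tailsᵉ zero    x = refl
    eval-tailsᵉ (suc q) x = cong tl (eval-tailsᵉ q x)

    module _ {n : I → ℕ} {q} {xs : ∀ i → Vec (Fin (n i)) q} {f : I → Tree} where

      dropTupleᶜ : μ ⊢ (λ i → tuple (xs i) (f i)) ⟶ f
      dropTupleᶜ = expr (tailsᵉ q) λ i _ _ → trans (eval-tailsᵉ q _) (tails-tuple (xs i) (f i))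

      lookupᶜ : ∀ j → μ ⊢ (λ i → tuple (xs i) (f i)) ⟶ (λ i → vert (lookup (xs i) j))
      lookupᶜ j = expr (hdᵉ (tailsᵉ (toℕ j))) λ i _ _ →
        trans (cong hd (eval-tailsᵉ (toℕ j) _)) (hd-tails-tuple (xs i) (f i) j)

  -- For fixed `q` the search is `q` nested vertex loops and stays polynomial. The outer loops
  -- choose the tail of the tuple, the innermost its head.
  ∃Vecᵈ : ∀ {I : Set ℓ} {μ : I → ℕ} {f : I → Tree} {n : I → ℕ} → PolyBounded μ n → μ ⊢ f ⟶ (verts ∘ n) →
          ∀ q {P : Σ I (λ i → Vec (Fin (n i)) q) → Set} →
          (μ ∘ proj₁) ⊢ (λ (i , xs) → tuple xs (f i)) ⊩ P → μ ⊢ f ⊩ (λ i → ∃ λ xs → P (i , xs))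
  ∃Vecᵈ n≤ V zero    D = mapᵈ (λ i → mk⇔ ([] ,_) λ { ([] , p) → p }) (reindexᵈ (λ i → i , []) D)
  ∃Vecᵈ n≤ V (suc q) D = mapᵈ (λ i → mk⇔ (λ (xs , x , p) → x ∷ xs , p) λ { (x ∷ xs , p) → xs , x , p })
    (∃Vecᵈ n≤ V q (∃ᵈ (pb-reindex proj₁ n≤) (dropTupleᶜ {xs = proj₂} ≫ reindex proj₁ V)
                      (reindexᵈ (λ ((i , xs) , x) → i , x ∷ xs) D)))

  -- A counterexample is searched for. Since `D` decides the body, the double negation can be
  -- removed.
  ∀ᵈ : ∀ {I : Set ℓ} {μ : I → ℕ} {f : I → Tree} {n : I → ℕ} → PolyBounded μ n → μ ⊢ f ⟶ (verts ∘ n) →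
       {P : Σ I (Fin ∘ n) → Set} → (μ ∘ proj₁) ⊢ (λ (i , v) → vert v ∙ f i) ⊩ P →
       μ ⊢ f ⊩ (λ i → ∀ v → P (i , v))
  ∀ᵈ n≤ V D = mapᵈ
    (λ i → mk⇔ (λ ¬∃ v → Dec.decidable-stable (Dec.map (correct D (i , v)) (T? _)) λ ¬p → ¬∃ (v , ¬p))
               (λ all (v , ¬p) → ¬p (all v)))
    (¬ᵈ ∃ᵈ n≤ V (¬ᵈ D))

  module _ {I : Set ℓ} {μ : I → ℕ} (G : I → Graph) (n≤ : PolyBounded μ (order ∘ G)) where

    baseᶜ : μ ⊢ (codeGraph ∘ G) ⟶ (base ∘ G)
    baseᶜ = ⟪ vertsᶜ G n≤ idᶜ , idᶜ ⟫

    deletedᶜ : ∀ p (w : ∀ i → Vec (Vertex (G i)) (p * 2)) →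
               μ ⊢ (λ i → tuple (w i) (base (G i))) ⟶ (λ i → codeGraph (G i ─ edges p (w i)))
    deletedᶜ p w = codeGraphᶜ (λ i → G i ─ edges p (w i)) n≤ (dropTupleᶜ {xs = w} ≫ firstᶜ)
      (mapᵈ (λ ((i , u) , v) → ⇔.sym (adj-─ (G i) (edges p (w i))))
        (Adjᵈ (λ ((i , _) , _) → G i) n≤″ (dropᶜ ≫ dropᶜ ≫ dropTupleᶜ {xs = λ ((i , _) , _) → w i} ≫ dropᶜ) U V ×ᵈ
         (¬ᵈ mapᵈ (λ ((i , u) , v) → ⇔.sym (joined⇔ p (w i)))
               (any-Finᵈ λ j → (≡ᵈ n≤″ U (end (combine j zero)) ×ᵈ ≡ᵈ n≤″ V (end (combine j (suc zero))))
                             ⊎ᵈ (≡ᵈ n≤″ V (end (combine j zero)) ×ᵈ ≡ᵈ n≤″ U (end (combine j (suc zero))))))))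
      where
      Pairs = Σ (Σ I (Vertex ∘ G)) (Vertex ∘ G ∘ proj₁)
      env : Pairs → Tree
      env ((i , u) , v) = vert v ∙ (vert u ∙ tuple (w i) (base (G i)))
      n≤″ : PolyBounded {I = Pairs} (μ ∘ proj₁ ∘ proj₁) (order ∘ G ∘ proj₁ ∘ proj₁)
      n≤″ = pb-reindex (proj₁ ∘ proj₁) n≤
      U : (μ ∘ proj₁ ∘ proj₁) ⊢ env ⟶ (λ ((i , u) , v) → vert u)
      U = secondᶜ
      V : (μ ∘ proj₁ ∘ proj₁) ⊢ env ⟶ (λ ((i , u) , v) → vert v)
      V = firstᶜ
      end : ∀ j → (μ ∘ proj₁ ∘ proj₁) ⊢ env ⟶ (λ ((i , u) , v) → vert (lookup (w i) j))
      end j = dropᶜ ≫ dropᶜ ≫ lookupᶜ {xs = λ ((i , _) , _) → w i} j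

    γ≤ᵈ : ∀ k → μ ⊢ (base ∘ G) ⊩ (λ i → γ[ G i ]≤ k)
    γ≤ᵈ k = mapᵈ (λ i → ⇔.sym (γ≤-tuple (G i)))
      (any-Finᵈ λ q → ∃Vecᵈ n≤ firstᶜ (toℕ q)
        (∀ᵈ (pb-reindex proj₁ n≤) (dropTupleᶜ {xs = proj₂} ≫ firstᶜ)
          (any-Finᵈ λ l → ≡ᵈ (pb-reindex (proj₁ ∘ proj₁) n≤) firstᶜ (dropᶜ ≫ lookupᶜ {xs = λ ((_ , xs) , _) → xs} l)
                       ⊎ᵈ Adjᵈ (λ ((i , _) , _) → G i) (pb-reindex (proj₁ ∘ proj₁) n≤)
                               (dropᶜ ≫ dropTupleᶜ {xs = λ ((_ , xs) , _) → xs} ≫ dropᶜ) firstᶜ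
                               (dropᶜ ≫ lookupᶜ {xs = λ ((_ , xs) , _) → xs} l))))

  module _ {I : Set ℓ} {μ : I → ℕ} where

    doesᶜ : ∀ {f} {P : I → Set} (P? : ∀ i → Dec (P i)) → μ ⊢ f ⊩ P → μ ⊢ f ⟶ (λ i → codeBool (does (P? i)))
    doesᶜ P? D = computes D ≡ᶜ λ i → cong codeBool (T-injective (⇔.trans (correct D i) (⇔.sym (T-does (P? i)))))

  leafᶜ : ∀ {I : Set ℓ} {μ : I → ℕ} (G : I → Graph) → PolyBounded μ (order ∘ G) → (x : ∀ i → Vertex (G i)) →
          μ ⊢ (λ i → vert (x i) ∙ base (G i)) ⟶ (λ i → codeGraph (leaf (G i) (x i)))
  leafᶜ {I = I} {μ} G n≤ x =
    ⟪ ⟪ falseᶜ , mapVertsᶜ n≤ secondᶜ isX ⟫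
    , mapVertsᶜ n≤ secondᶜ ⟪ isX , nthᶜ n≤′ {proj₂} {enc = λ (i , _) u → codeList (λ v → codeBool (adj (G i) u v)) (allFin _)}
                                     firstᶜ (dropᶜ ≫ dropᶜ ≫ dropᶜ ≡ᶜ λ (i , _) → codeGraph-allFin (G i)) ⟫ ⟫
    ≡ᶜ λ i → sym (codeGraph-leaf (G i) (x i))
    where
    n≤′ : PolyBounded {I = Σ I (Vertex ∘ G)} (μ ∘ proj₁) (order ∘ G ∘ proj₁)
    n≤′ = pb-reindex proj₁ n≤
    isX : _⊢_⟶_ {I = Σ I (Vertex ∘ G)} (μ ∘ proj₁) (λ (i , v) → vert v ∙ (vert (x i) ∙ base (G i)))
                                                   (λ (i , v) → codeBool (does (x i Fin.≟ v)))
    isX = doesᶜ (λ (i , v) → x i Fin.≟ v) (≡ᵈ n≤′ secondᶜ firstᶜ)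

  tuple-head-tail : ∀ {n q} (xs : Vec (Fin n) (suc q)) y → tuple xs y ≡ vert (Vec.head xs) ∙ tuple (Vec.tail xs) y
  tuple-head-tail (x ∷ xs) y = refl

  shiftᶜ : ∀ {I : Set ℓ} {μ : I → ℕ} {n : I → ℕ} {q} (xs : ∀ i → Vec (Fin (n i)) q) {f g h : I → Tree} →
           μ ⊢ f ⟶ (λ i → tuple (xs i) (g i)) → μ ⊢ f ⟶ h → μ ⊢ f ⟶ (λ i → tuple (Vec.map suc (xs i)) (h i))
  shiftᶜ {q = zero}  xs F H = H ≡ᶜ λ i → empty (xs i)
    where
    empty : ∀ {n} (xs : Vec (Fin n) 0) {y} → y ≡ tuple (Vec.map suc xs) y
    empty [] = refl
  shiftᶜ {q = suc q} xs F H =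
    ⟪ F′ ≫ expr (consᵉ nilᵉ (hdᵉ v₀)) (λ _ _ _ → refl) , shiftᶜ (Vec.tail ∘ xs) (F′ ≫ dropᶜ) H ⟫
    ≡ᶜ λ i → cons (xs i)
    where
    F′ = F ≡ᶜ λ i → tuple-head-tail (xs i) _
    cons : ∀ {n} (xs : Vec (Fin n) (suc q)) {y} →
           vert (suc (Vec.head xs)) ∙ tuple (Vec.map suc (Vec.tail xs)) y ≡ tuple (Vec.map suc xs) y
    cons (x ∷ xs) = refl

  attachᶜ : ∀ {I : Set ℓ} {μ : I → ℕ} (G : I → Graph) → PolyBounded μ (order ∘ G) →
            ∀ {q} (xs : ∀ i → Vec (Vertex (G i)) q) {f g : I → Tree} →
            μ ⊢ f ⟶ (λ i → tuple (xs i) (g i)) → μ ⊢ f ⟶ (base ∘ G) →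
            μ ⊢ f ⟶ (λ i → codeGraph (attach (G i) (xs i)))
  attachᶜ G n≤ {zero} xs F B = B ≫ dropᶜ ≡ᶜ λ i → unattached (G i) (xs i)
    where
    unattached : ∀ G (xs : Vec (Vertex G) 0) → codeGraph G ≡ codeGraph (attach G xs)
    unattached G [] = refl
  attachᶜ G n≤ {suc q} xs F B =
    -- After each pendant vertex the remaining roots are renumbered and the list of vertices is
    -- recomputed, since the new vertex is vertex 0.
    shiftᶜ (Vec.tail ∘ xs) (F′ ≫ dropᶜ) (⟪ F′ ≫ firstᶜ , B ⟫ ≫ leafᶜ G n≤ (Vec.head ∘ xs) ≫ baseᶜ G′ (pb-suc n≤))
    ≫ attachᶜ G′ (pb-suc n≤) xs′ idᶜ (dropTupleᶜ {xs = xs′})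
    ≡ᶜ λ i → attached (G i) (xs i)
    where
    F′ = F ≡ᶜ λ i → tuple-head-tail (xs i) _
    G′ = λ i → leaf (G i) (Vec.head (xs i))
    xs′ = λ i → Vec.map suc (Vec.tail (xs i))
    attached : ∀ G (xs : Vec (Vertex G) (suc q)) →
               codeGraph (attach (leaf G (Vec.head xs)) (Vec.map suc (Vec.tail xs))) ≡ codeGraph (attach G xs)
    attached G (x ∷ xs) = refl

  -- From tests on lists of pairs to bondage.

  module Bondage-in (d : ℕ) (C : Pred Graph ℓ) where

    -- Membership in `C` is part of the index, not of the data, so that it is available in
    -- correctness proofs and costs no time.
    Input : Set ℓ
    Input = Σ Graph C

    Deletion : ℕ → Set ℓ
    Deletion p = Σ Input λ (G , _) → Vec (Vertex G) (p * 2)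

    inputSize : Input → ℕ
    inputSize (G , _) = size (codeGraph G)

    order≤inputSize : PolyBounded inputSize (order ∘ proj₁)
    order≤inputSize = pb-mono (order≤size ∘ proj₁) pb-self

    -- Since `d` is fixed, the lengths `p` up to `d` are treated by separate pieces of program, each
    -- searching through tuples of `p * 2` vertices.
    bondage : (∀ p → _⊢_⊩_ {I = Deletion p} (inputSize ∘ proj₁) (λ ((G , _) , w) → tuple w (base G))
                                                        (λ ((G , _) , w) → Increases G (edges p w))) →
              BondagePolyTimeFor d C
    -- The stack comes on top of the `a` scratch variables and starts as nil.
    bondage D = record { auxiliary = suc a ; body = cmd (computes D′) } , c , k , λ G G∈C →
      let τ , t , r , t≤ = run (computes D′) (G , G∈C) nil (Vec.replicate a nil) in
      decide D′ (G , G∈C) , t , ((_ , r , refl) , ≤-trans t≤ (b≤ (G , G∈C)) , correct D′ (G , G∈C))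
      where
      D′ : inputSize ⊢ (codeGraph ∘ proj₁) ⊩ (λ (G , _) → b[ G ]≤ d)
      D′ = baseᶜ proj₁ order≤inputSize ≫ᵈ mapᵈ (λ (G , _) → ⇔.sym (bondage⇔ G))
             (any-Finᵈ λ p → ∃Vecᵈ order≤inputSize firstᶜ (toℕ p * 2) (D (toℕ p)))
      c = proj₁ (poly (computes D′))
      k = proj₁ (proj₂ (poly (computes D′)))
      b≤ = proj₂ (proj₂ (poly (computes D′)))

    module _ (p : ℕ) where

      Threshold : Set ℓ
      Threshold = Σ (Deletion p) λ ((G , _) , _) → Vertex G

      threshold : Threshold → Tree
      threshold (((G , _) , w) , j) = vert j ∙ tuple w (base G)

      order≤ : PolyBounded {I = Threshold} (inputSize ∘ proj₁ ∘ proj₁) (λ (((G , _) , _) , _) → order G)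
      order≤ = pb-reindex (proj₁ ∘ proj₁) order≤inputSize

      increases-by-threshold :
        (inputSize ∘ proj₁ ∘ proj₁) ⊢ threshold ⊩ (λ (((G , _) , w) , j) → γ[ G ]≤ suc (toℕ j)) →
        (inputSize ∘ proj₁ ∘ proj₁) ⊢ threshold ⊩ (λ (((G , _) , w) , j) → γ[ G ─ edges p w ]≤ suc (toℕ j)) →
        _⊢_⊩_ {I = Deletion p} (inputSize ∘ proj₁) (λ ((G , _) , w) → tuple w (base G))
                                           (λ ((G , _) , w) → Increases G (edges p w))
      increases-by-threshold D E = mapᵈ (λ ((G , _) , w) → ⇔.sym (increases-threshold G (edges p w)))
        (∃ᵈ (pb-reindex proj₁ order≤inputSize) (dropTupleᶜ {xs = proj₂} ≫ firstᶜ) (D ×ᵈ (¬ᵈ E)))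

    bounded : ∀ K → (∀ G → C G → γ[ G ]≤ K) → BondagePolyTimeFor d C
    bounded K γ≤K = bondage λ p → mapᵈ (λ ((G , G∈C) , w) → ⇔.sym (increases-bounded G (edges p w) (γ≤K G G∈C)))
      (any-Finᵈ λ k →
        (dropTupleᶜ {xs = proj₂} ≫ᵈ γ≤ᵈ (λ ((G , _) , _) → G) (pb-reindex proj₁ order≤inputSize) (toℕ k)) ×ᵈ
        (¬ᵈ (deletedᶜ (λ ((G , _) , _) → G) (pb-reindex proj₁ order≤inputSize) p proj₂ ≫
             baseᶜ (λ ((G , _) , w) → G ─ edges p w) (pb-reindex proj₁ order≤inputSize) ≫ᵈ
             γ≤ᵈ (λ ((G , _) , w) → G ─ edges p w) (pb-reindex proj₁ order≤inputSize) (toℕ k))))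

-- Algorithms that call a solver for Dominating Set.

module WithOracle (C : Pred Graph ℓ) (solvable : DominatingSetPolyTimeFor C) (d : ℕ) where

  private
    P = proj₁ solvable
    c = proj₁ (proj₂ solvable)
    k = proj₁ (proj₂ (proj₂ solvable))
    runs = proj₂ (proj₂ (proj₂ solvable))

  open Language (auxiliary P)
  open Vertices (auxiliary P)
  open Algorithms (auxiliary P)
  open Bondage-in d C

  -- The size of the query is polynomial in the order and the threshold, hence in `μ i`, so the time
  -- bound of the solver becomes one in `μ i`.
  oracleᵈ : ∀ {I : Set ℓ} {μ : I → ℕ} {f} (G : I → Graph) (l : I → ℕ) → (∀ i → C (G i)) →
            PolyBounded μ (order ∘ G) → PolyBounded μ l →
            μ ⊢ f ⟶ (codeGraph ∘ G) → μ ⊢ f ⟶ (num ∘ l) → μ ⊢ f ⊩ (λ i → γ[ G i ]≤ suc (l i))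
  oracleᵈ {μ = μ} G l G∈C n≤ l≤ M L = record
    { decide   = λ i → proj₁ (answer i)
    ; computes = ⟪ M , L ≫ expr (consᵉ nilᵉ v₀) (λ _ _ _ → refl) ≫ codeℕᶜ (pb-suc l≤) idᶜ ⟫
                 ≫ runᶜ (body P) (λ i → c * suc (size (code DominatingSet (instance′ i))) ^ k)
                     (pb-* (pb-const c) (pb-^ (pb-suc size≤) k))
                     (λ i → let _ , t , (ρ , r , eq) , t≤ , _ = answer i in ρ , (t , r , t≤) , eq)
    ; correct  = λ i → let _ , _ , _ , _ , correct = answer i in correct
    }
    where
    instance′ : ∀ i → Graph × ∃ λ k → 1 ≤ k
    instance′ i = G i , suc (l i) , s≤s z≤n
    answer = λ i → runs (instance′ i) (G∈C i)
    size≤ : PolyBounded μ (λ i → size (code DominatingSet (instance′ i)))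
    size≤ = pb-suc (pb-+
      (pb-mono (size-codeGraph ∘ G) (pb-suc (pb-* n≤ (pb-suc (pb-suc (pb-* n≤ (pb-const 4)))))))
      (pb-mono (λ i → size-codeℕ (suc (l i))) (pb-suc (pb-* (pb-suc l≤) (pb-const 4)))))

  module _ (p : ℕ) where

    γ≤-undeletedᵈ : (inputSize ∘ proj₁ ∘ proj₁) ⊢ threshold p ⊩ (λ (((G , _) , w) , j) → γ[ G ]≤ suc (toℕ j))
    γ≤-undeletedᵈ = oracleᵈ (λ (((G , _) , _) , _) → G) (λ (_ , j) → toℕ j) (λ (((_ , G∈C) , _) , _) → G∈C)
      (order≤ p) (toℕ≤ (order≤ p) proj₂) (dropᶜ ≫ dropTupleᶜ {xs = λ ((_ , w) , _) → w} ≫ dropᶜ) firstᶜ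

  closed : ClosedUnderEdgeDeletion C → BondagePolyTimeFor d C
  closed closed = bondage λ p → increases-by-threshold p (γ≤-undeletedᵈ p) (γ≤-deletedᵈ p)
    where
    deleted : ∀ p (t : Threshold p) → _
    deleted p (((G , G∈C) , w) , _) = closed-─ {C = C} closed G G∈C (edges p w)
    K : ∀ p → Threshold p → Graph
    K p t@(((G , _) , _) , _) = let A , s , i , _ = deleted p t in graph (order G) A s i
    γ≤-deletedᵈ : ∀ p → _ ⊢ threshold p ⊩ (λ (((G , _) , w) , j) → γ[ G ─ edges p w ]≤ suc (toℕ j))
    γ≤-deletedᵈ p = mapᵈ
      (λ t@(((G , _) , w) , j) → let A , s , i , _ , A≡ = deleted p t ; G′ = G ─ edges p w in mk⇔
        (γ≤-⊆ {s = s} {i} {s′ = adj-sym G′} {adj-irrefl G′} λ u v → subst T (A≡ u v))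
        (γ≤-⊆ {s = adj-sym G′} {adj-irrefl G′} {s′ = s} {i} λ u v → subst T (sym (A≡ u v))))
      (oracleᵈ (K p) (λ (_ , j) → toℕ j) (λ t → let _ , _ , _ , K∈C , _ = deleted p t in K∈C)
        (order≤ p) (toℕ≤ (order≤ p) proj₂)
        -- The program writes the matrix of `G ─ edges p w`. As `K` has the same adjacency, this is
        -- also the code of a member of `C`.
        (dropᶜ ≫ deletedᶜ (λ (((G , _) , _) , _) → G) (order≤ p) p (λ ((_ , w) , _) → w)
         ≡ᶜ λ t@(((G , _) , w) , _) → let A , s , i , _ , A≡ = deleted p t ; G′ = G ─ edges p w in
              codeGraph-cong {s = adj-sym G′} {adj-irrefl G′} {s′ = s} {i} λ u v → sym (A≡ u v))
        firstᶜ)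

  free : ∀ {H} → (∀ a → 2 ≤ degree H a) → (∀ G → C G ⇔ Free H G) → BondagePolyTimeFor d C
  free {H} 2≤degree C⇔ = bondage λ p → increases-by-threshold p (γ≤-undeletedᵈ p) (γ≤-deletedᵈ p)
    where
    γ≤-deletedᵈ : ∀ p → _ ⊢ threshold p ⊩ (λ (((G , _) , w) , j) → γ[ G ─ edges p w ]≤ suc (toℕ j))
    γ≤-deletedᵈ p = mapᵈ (λ (((G , _) , w) , j) → ⇔.sym (γ≤-guards G p w))
      (∃Vecᵈ (order≤ p) (dropᶜ ≫ dropTupleᶜ {xs = λ ((_ , w) , _) → w} ≫ firstᶜ) (p * 2) (guardsᵈ ×ᵈ
        oracleᵈ (λ ((((G , _) , _) , _) , xs) → attach G xs) (λ ((_ , j) , _) → toℕ j)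
          (λ ((((G , G∈C) , _) , _) , xs) → from (C⇔ (attach G xs)) (attach-free {H} 2≤degree G xs (to (C⇔ G) G∈C)))
          -- The number of pendant vertices is the constant `p * 2`, so the order stays polynomially
          -- bounded.
          (pb-mono (λ ((((G , _) , _) , _) , xs) → ≤-reflexive (order-attach G xs)) (pb-+ (pb-const (p * 2)) n≤))
          (toℕ≤ n≤ λ ((_ , j) , _) → j)
          (attachᶜ (λ ((((G , _) , _) , _) , _) → G) n≤ proj₂ idᶜ
            (dropTupleᶜ {xs = proj₂} ≫ dropᶜ ≫ dropTupleᶜ {xs = λ (((_ , w) , _) , _) → w}))
          (dropTupleᶜ {xs = proj₂} ≫ firstᶜ)))
      where
      Guarding : Set _
      Guarding = Σ (Threshold p) λ (((G , _) , _) , _) → Vec (Vertex G) (p * 2)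
      n≤ : PolyBounded {I = Guarding} _ (λ ((((G , _) , _) , _) , _) → order G)
      n≤ = pb-reindex proj₁ (order≤ p)
      env : Guarding → Tree
      env (t , xs) = tuple xs (threshold p t)
      guardsᵈ : _⊢_⊩_ {I = Guarding} _ env (λ ((((G , _) , w) , _) , xs) → Guards G p w xs)
      guardsᵈ = all-Finᵈ λ j → ≡ᵈ n≤ (end j) (guard j)
                            ⊎ᵈ Adjᵈ (λ ((((G , _) , w) , _) , _) → G ─ edges p w) n≤
                                    (dropTupleᶜ {xs = proj₂} ≫ dropᶜ ≫
                                     deletedᶜ (λ ((((G , _) , _) , _) , _) → G) n≤ p (λ (((_ , w) , _) , _) → w))
                                    (end j) (guard j)
        where
        end : ∀ j → _⊢_⟶_ {I = Guarding} _ env (λ (((_ , w) , _) , _) → vert (lookup w j))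
        end j = dropTupleᶜ {xs = proj₂} ≫ dropᶜ ≫ lookupᶜ {xs = λ (((_ , w) , _) , _) → w} j
        guard : ∀ j → _⊢_⟶_ {I = Guarding} _ env (λ (_ , xs) → vert (lookup xs j))
        guard = lookupᶜ {xs = proj₂}

proposition4p9 : ∀ {ℓ : Level} (d : ℕ) → 1 ≤ d → (C : Pred Graph ℓ) →
    (ClosedUnderEdgeDeletion C × DominatingSetPolyTimeFor C)
    ⊎ ((∃ λ (H : Graph) → (∃ λ (δ : ℕ) → IsMinimumDegree H δ × 2 ≤ δ) × (∀ G → C G ⇔ Free H G)) × DominatingSetPolyTimeFor C)
    ⊎ (∃ λ (k : ℕ) → ∀ G → C G → γ[ G ]≤ k) →
    BondagePolyTimeFor d C
proposition4p9 d _ C (inj₁ (closed , ds)) =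
  WithOracle.closed C ds d closed
proposition4p9 d _ C (inj₂ (inj₁ ((H , (δ , (_ , δ≤) , 2≤δ) , C⇔) , ds))) =
  WithOracle.free C ds d {H = H} (λ a → ≤-trans 2≤δ (δ≤ _ (a , refl))) C⇔
proposition4p9 d _ C (inj₂ (inj₂ (K , γ≤K))) =
  -- No solver is called in this case, hence the number 0 of scratch variables.
  Algorithms.Bondage-in.bounded 0 d C K γ≤K
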